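{- There are sets of $n$ points in $\mathbb{R}^3$ for which the number of unit-volume tetrahedra determined by the $n$ points is $\Omega(n^3\log\log n)$.
   Context: A tetrahedron determined by a finite set $S\subset\mathbb{R}^3$ is a tetrahedron whose four vertices are points of $S$. It is unit-volume if its volume is $1$. The constant hidden in $\Omega(\cdot)$ is absolute, and the bound is asserted for all sufficiently large $n$. -}

module Defs where

open import Data.Nat.Base as ℕ using (ℕ; zero; suc; z≤n; s≤s)
import Data.Nat.Properties as ℕₚ
import Data.Nat.DivMod as ℕd
open import Data.Nat.Induction using (<-rec)
open import Data.Nat.Logarithm
  using (⌊log₂_⌋; ⌊log₂⌋-mono-≤; ⌊log₂[2^n]⌋≡n; ⌊log₂⌊n/2⌋⌋≡⌊log₂n⌋∸1)
open import Data.Integer.Base as ℤ using (+_; -[1+_])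
import Data.Integer.Properties as ℤₚ
open import Data.Rational.Base as ℚ using (ℚ; mkℚ; 0ℚ; 1ℚ; ½; _/_; floor)
import Data.Rational.Properties as ℚₚ
open import Data.Rational.Unnormalised.Base as ℚᵘ using (mkℚᵘ)
import Data.Rational.Unnormalised.Properties as ℚᵘₚ
open import Data.Rational.Solver using (module +-*-Solver)
import Algebra.Properties.CommutativeSemiring.Exp as CExp
open import Algebra.Bundles using (CommutativeRing)
open import Data.Fin.Base as Fin using (Fin)
open import Data.List.Base using (length)
open import Data.List.Membership.Propositional using (_∈_)
open import Data.List.Relation.Unary.Unique.Propositional using (Unique)
open import Data.Product.Base using (_×_; _,_; ∃-syntax; proj₁; proj₂)
open import Data.Sum.Base using (inj₁; inj₂)
open import Data.Empty using (⊥-elim)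
open import Function.Bundles using (_⇔_)
open import Relation.Binary.PropositionalEquality
  using (_≡_; refl; sym; trans; cong; cong₂; subst; subst₂; module ≡-Reasoning)

private
  ℚ-semiring = CommutativeRing.commutativeSemiring ℚₚ.+-*-commutativeRing
  module E = CExp ℚ-semiring

infixr 8 _^ℚ_
_^ℚ_ : ℚ → ℕ → ℚ
_^ℚ_ = E._^_

ι : ℕ → ℚ
ι n = + n / 1

Eventually : (ℕ → Set) → Set
Eventually P = ∃[ N ] ∀ n → N ℕ.≤ n → P n

IsCauchy : (ℕ → ℚ) → Set
IsCauchy f = ∀ ε → 0ℚ ℚ.< ε →
  ∃[ N ] ∀ m n → N ℕ.≤ m → N ℕ.≤ n → ℚ.∣ f m ℚ.- f n ∣ ℚ.≤ ε

-- Real numbers are Cauchy sequences of rationals, considered up to _≃_ below.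
record ℝ : Set where
  constructor mkℝ
  field
    seq    : ℕ → ℚ
    cauchy : IsCauchy seq
open ℝ public

module CauchyLemmas where

  open +-*-Solver using (solve; _:+_; _:*_; _:-_; :-_; con; _:=_)

  OneSided : (ℕ → ℚ) → Set
  OneSided f = ∀ ε → 0ℚ ℚ.< ε →
    ∃[ N ] ∀ m n → N ℕ.≤ m → N ℕ.≤ n → f m ℚ.- f n ℚ.≤ ε

  p≤∣p∣ : ∀ p → p ℚ.≤ ℚ.∣ p ∣
  p≤∣p∣ p with ℚₚ.≤-total 0ℚ p
  ... | inj₁ 0≤p = ℚₚ.≤-reflexive (sym (ℚₚ.0≤p⇒∣p∣≡p 0≤p))
  ... | inj₂ p≤0 = ℚₚ.≤-trans p≤0 (ℚₚ.0≤∣p∣ p)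

  -‿swap : ∀ p q → ℚ.- (p ℚ.- q) ≡ q ℚ.- p
  -‿swap = solve 2 (λ p q → :- (p :- q) := q :- p) refl

  ∣p-q∣≤ : ∀ p q {ε} → p ℚ.- q ℚ.≤ ε → q ℚ.- p ℚ.≤ ε → ℚ.∣ p ℚ.- q ∣ ℚ.≤ ε
  ∣p-q∣≤ p q {ε} a b with ℚₚ.∣p∣≡p∨∣p∣≡-p (p ℚ.- q)
  ... | inj₁ e = subst (ℚ._≤ ε) (sym e) a
  ... | inj₂ e = subst (ℚ._≤ ε) (sym (trans e (-‿swap p q))) b

  fromOneSided : ∀ {f} → OneSided f → IsCauchy f
  fromOneSided {f} h ε ε>0 with h ε ε>0
  ... | N , k = N , λ m n a b → ∣p-q∣≤ (f m) (f n) (k m n a b) (k n m b a)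

  toOneSided : ∀ {f} → IsCauchy f → OneSided f
  toOneSided h ε ε>0 with h ε ε>0
  ... | N , k = N , λ m n a b → ℚₚ.≤-trans (p≤∣p∣ _) (k m n a b)

  half : ∀ ε → 0ℚ ℚ.< ε → 0ℚ ℚ.< ½ ℚ.* ε
  half ε ε>0 = ℚₚ.positive⁻¹ _ {{ℚₚ.pos*pos⇒pos ½ ε {{ℚ.positive ε>0}}}}

  halves : ∀ ε → ½ ℚ.* ε ℚ.+ ½ ℚ.* ε ≡ ε
  halves ε = trans (sym (ℚₚ.*-distribʳ-+ ε ½ ½)) (ℚₚ.*-identityˡ ε)

  const : ∀ q → IsCauchy (λ _ → q)
  const q ε ε>0 = 0 , λ _ _ _ _ →
    subst (λ z → ℚ.∣ z ∣ ℚ.≤ ε) (sym (ℚₚ.+-inverseʳ q)) (ℚₚ.<⇒≤ ε>0)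

  neg : ∀ {f} → IsCauchy f → IsCauchy (λ n → ℚ.- f n)
  neg {f} h = fromOneSided {λ n → ℚ.- f n} λ ε ε>0 → let (N , k) = toOneSided {f} h ε ε>0 in
    N , λ m n a b → subst (ℚ._≤ ε) (flip (f m) (f n)) (k n m b a)
    where
    flip : ∀ p q → q ℚ.- p ≡ ℚ.- p ℚ.- (ℚ.- q)
    flip = solve 2 (λ p q → q :- p := :- p :- (:- q)) refl

  add : ∀ {f g} → IsCauchy f → IsCauchy g → IsCauchy (λ n → f n ℚ.+ g n)
  add {f} {g} hf hg = fromOneSided {λ n → f n ℚ.+ g n} λ ε ε>0 →
    let (M , k) = toOneSided {f} hf (½ ℚ.* ε) (half ε ε>0)
        (N , l) = toOneSided {g} hg (½ ℚ.* ε) (half ε ε>0)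
    in M ℕ.⊔ N , λ m n a b →
      subst₂ ℚ._≤_ (regroup (f m) (f n) (g m) (g n)) (halves ε)
        (ℚₚ.+-mono-≤ (k m n (ℕₚ.m⊔n≤o⇒m≤o M N a) (ℕₚ.m⊔n≤o⇒m≤o M N b))
                     (l m n (ℕₚ.m⊔n≤o⇒n≤o M N a) (ℕₚ.m⊔n≤o⇒n≤o M N b)))
    where
    regroup : ∀ p q r s → (p ℚ.- q) ℚ.+ (r ℚ.- s) ≡ (p ℚ.+ r) ℚ.- (q ℚ.+ s)
    regroup = solve 4 (λ p q r s → (p :- q) :+ (r :- s) := (p :+ r) :- (q :+ s)) refl

  -- ∣p∣ - ∣q∣ ≤ ∣p - q∣
  ∣∣-lipschitz : ∀ p q → ℚ.∣ p ∣ ℚ.- ℚ.∣ q ∣ ℚ.≤ ℚ.∣ p ℚ.- q ∣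
  ∣∣-lipschitz p q = subst (ℚ.∣ p ∣ ℚ.- ℚ.∣ q ∣ ℚ.≤_) (cancel ℚ.∣ p ℚ.- q ∣ ℚ.∣ q ∣)
    (ℚₚ.+-monoˡ-≤ (ℚ.- ℚ.∣ q ∣)
      (subst (λ z → ℚ.∣ z ∣ ℚ.≤ ℚ.∣ p ℚ.- q ∣ ℚ.+ ℚ.∣ q ∣) (restore p q)
        (ℚₚ.∣p+q∣≤∣p∣+∣q∣ (p ℚ.- q) q)))
    where
    cancel : ∀ a b → (a ℚ.+ b) ℚ.- b ≡ a
    cancel = solve 2 (λ a b → (a :+ b) :- b := a) refl
    restore : ∀ a b → (a ℚ.- b) ℚ.+ b ≡ a
    restore = solve 2 (λ a b → (a :- b) :+ b := a) refl

  abs : ∀ {f} → IsCauchy f → IsCauchy (λ n → ℚ.∣ f n ∣)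
  abs {f} h = fromOneSided {λ n → ℚ.∣ f n ∣} λ ε ε>0 → let (N , k) = h ε ε>0 in
    N , λ m n a b → ℚₚ.≤-trans (∣∣-lipschitz (f m) (f n)) (k m n a b)

  bounded : ∀ {f} → IsCauchy f →
            ∃[ B ] 0ℚ ℚ.< B × Eventually (λ n → ℚ.∣ f n ∣ ℚ.≤ B)
  bounded {f} h = 1ℚ ℚ.+ ℚ.∣ f N ∣ , positive , N , bound
    where
    absCauchy : ∃[ N ] ∀ m n → N ℕ.≤ m → N ℕ.≤ n →
                ℚ.∣ ℚ.∣ f m ∣ ℚ.- ℚ.∣ f n ∣ ∣ ℚ.≤ 1ℚ
    absCauchy = abs {f} h 1ℚ (ℚₚ.positive⁻¹ 1ℚ)
    N = proj₁ absCauchy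
    positive : 0ℚ ℚ.< 1ℚ ℚ.+ ℚ.∣ f N ∣
    positive = ℚₚ.positive⁻¹ (1ℚ ℚ.+ ℚ.∣ f N ∣)
      {{ℚₚ.pos+nonNeg⇒pos 1ℚ ℚ.∣ f N ∣ {{ℚₚ.∣-∣-nonNeg (f N)}}}}
    restore : ∀ a b → (a ℚ.- b) ℚ.+ b ≡ a
    restore = solve 2 (λ a b → (a :- b) :+ b := a) refl
    bound : ∀ n → N ℕ.≤ n → ℚ.∣ f n ∣ ℚ.≤ 1ℚ ℚ.+ ℚ.∣ f N ∣
    bound n a = begin
      ℚ.∣ f n ∣                                    ≡⟨ restore ℚ.∣ f n ∣ ℚ.∣ f N ∣ ⟨
      (ℚ.∣ f n ∣ ℚ.- ℚ.∣ f N ∣) ℚ.+ ℚ.∣ f N ∣      ≤⟨ ℚₚ.+-monoˡ-≤ ℚ.∣ f N ∣ (p≤∣p∣ (ℚ.∣ f n ∣ ℚ.- ℚ.∣ f N ∣)) ⟩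
      ℚ.∣ ℚ.∣ f n ∣ ℚ.- ℚ.∣ f N ∣ ∣ ℚ.+ ℚ.∣ f N ∣  ≤⟨ ℚₚ.+-monoˡ-≤ ℚ.∣ f N ∣ (proj₂ absCauchy n N a ℕₚ.≤-refl) ⟩
      1ℚ ℚ.+ ℚ.∣ f N ∣                             ∎
      where open ℚₚ.≤-Reasoning

  ∣p*q∣≤ : ∀ p q {B δ} → 0ℚ ℚ.≤ B → ℚ.∣ p ∣ ℚ.≤ B → ℚ.∣ q ∣ ℚ.≤ δ →
           p ℚ.* q ℚ.≤ B ℚ.* δ
  ∣p*q∣≤ p q {B} {δ} 0≤B a b = ℚₚ.≤-trans (p≤∣p∣ _)
    (subst (ℚ._≤ B ℚ.* δ) (sym (ℚₚ.∣p*q∣≡∣p∣*∣q∣ p q))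
      (ℚₚ.≤-trans (ℚₚ.*-monoʳ-≤-nonNeg ℚ.∣ q ∣ {{ℚₚ.∣-∣-nonNeg q}} a)
                  (ℚₚ.*-monoˡ-≤-nonNeg B {{ℚ.nonNegative 0≤B}} b)))

  mul : ∀ {f g} → IsCauchy f → IsCauchy g → IsCauchy (λ n → f n ℚ.* g n)
  mul {f} {g} hf hg = fromOneSided {λ n → f n ℚ.* g n} λ ε ε>0 → K ε ε>0 , bound ε ε>0
    where
    bf = bounded {f} hf
    bg = bounded {g} hg
    B = proj₁ bf
    C = proj₁ bg
    B>0 : 0ℚ ℚ.< B
    B>0 = proj₁ (proj₂ bf)
    C>0 : 0ℚ ℚ.< C
    C>0 = proj₁ (proj₂ bg)
    M₁ = proj₁ (proj₂ (proj₂ bf))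
    M₂ = proj₁ (proj₂ (proj₂ bg))

    δ : ∀ B → 0ℚ ℚ.< B → ℚ → ℚ
    δ B B>0 ε = (ℚ.1/ B) {{ℚ.>-nonZero B>0}} ℚ.* (½ ℚ.* ε)

    δ>0 : ∀ B B>0 ε → 0ℚ ℚ.< ε → 0ℚ ℚ.< δ B B>0 ε
    δ>0 B B>0 ε ε>0 = ℚₚ.positive⁻¹ (δ B B>0 ε)
      {{ℚₚ.pos*pos⇒pos ((ℚ.1/ B) {{ℚ.>-nonZero B>0}}) {{ℚₚ.1/pos⇒pos B {{ℚ.positive B>0}}}}
                       (½ ℚ.* ε) {{ℚ.positive (half ε ε>0)}}}}

    B*δ : ∀ B B>0 ε → B ℚ.* δ B B>0 ε ≡ ½ ℚ.* ε
    B*δ B B>0 ε = begin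
      B ℚ.* (1/B ℚ.* (½ ℚ.* ε))  ≡⟨ ℚₚ.*-assoc B 1/B (½ ℚ.* ε) ⟨
      (B ℚ.* 1/B) ℚ.* (½ ℚ.* ε)  ≡⟨ cong (ℚ._* (½ ℚ.* ε)) (ℚₚ.*-inverseʳ B {{ℚ.>-nonZero B>0}}) ⟩
      1ℚ ℚ.* (½ ℚ.* ε)           ≡⟨ ℚₚ.*-identityˡ (½ ℚ.* ε) ⟩
      ½ ℚ.* ε                    ∎
      where
      open ≡-Reasoning
      1/B = (ℚ.1/ B) {{ℚ.>-nonZero B>0}}

    N₁ N₂ K : ∀ ε → 0ℚ ℚ.< ε → ℕ
    N₁ ε ε>0 = proj₁ (hf (δ C C>0 ε) (δ>0 C C>0 ε ε>0))
    N₂ ε ε>0 = proj₁ (hg (δ B B>0 ε) (δ>0 B B>0 ε ε>0))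
    K ε ε>0 = (M₁ ℕ.⊔ M₂) ℕ.⊔ (N₁ ε ε>0 ℕ.⊔ N₂ ε ε>0)

    split : ∀ p q r s → p ℚ.* r ℚ.- q ℚ.* s ≡ p ℚ.* (r ℚ.- s) ℚ.+ s ℚ.* (p ℚ.- q)
    split = solve 4 (λ p q r s → p :* r :- q :* s := p :* (r :- s) :+ s :* (p :- q)) refl

    bound : ∀ ε ε>0 m n → K ε ε>0 ℕ.≤ m → K ε ε>0 ℕ.≤ n →
            f m ℚ.* g m ℚ.- f n ℚ.* g n ℚ.≤ ε
    bound ε ε>0 m n a b = begin
      f m ℚ.* g m ℚ.- f n ℚ.* g n                      ≡⟨ split (f m) (f n) (g m) (g n) ⟩
      f m ℚ.* (g m ℚ.- g n) ℚ.+ g n ℚ.* (f m ℚ.- f n)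
        ≤⟨ ℚₚ.+-mono-≤
             {f m ℚ.* (g m ℚ.- g n)} {B ℚ.* δ B B>0 ε} {g n ℚ.* (f m ℚ.- f n)} {C ℚ.* δ C C>0 ε}
             (∣p*q∣≤ (f m) (g m ℚ.- g n) {B} {δ B B>0 ε} (ℚₚ.<⇒≤ B>0) f≤B g-close)
             (∣p*q∣≤ (g n) (f m ℚ.- f n) {C} {δ C C>0 ε} (ℚₚ.<⇒≤ C>0) g≤C f-close) ⟩
      B ℚ.* δ B B>0 ε ℚ.+ C ℚ.* δ C C>0 ε              ≡⟨ cong₂ ℚ._+_ (B*δ B B>0 ε) (B*δ C C>0 ε) ⟩
      ½ ℚ.* ε ℚ.+ ½ ℚ.* ε                              ≡⟨ halves ε ⟩
      ε                                                ∎
      where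
      open ℚₚ.≤-Reasoning
      M≤ : ∀ {k} → K ε ε>0 ℕ.≤ k → M₁ ℕ.⊔ M₂ ℕ.≤ k
      M≤ = ℕₚ.m⊔n≤o⇒m≤o (M₁ ℕ.⊔ M₂) (N₁ ε ε>0 ℕ.⊔ N₂ ε ε>0)
      N≤ : ∀ {k} → K ε ε>0 ℕ.≤ k → N₁ ε ε>0 ℕ.⊔ N₂ ε ε>0 ℕ.≤ k
      N≤ = ℕₚ.m⊔n≤o⇒n≤o (M₁ ℕ.⊔ M₂) (N₁ ε ε>0 ℕ.⊔ N₂ ε ε>0)
      f≤B : ℚ.∣ f m ∣ ℚ.≤ B
      f≤B = proj₂ (proj₂ (proj₂ bf)) m (ℕₚ.m⊔n≤o⇒m≤o M₁ M₂ (M≤ a))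
      g≤C : ℚ.∣ g n ∣ ℚ.≤ C
      g≤C = proj₂ (proj₂ (proj₂ bg)) n (ℕₚ.m⊔n≤o⇒n≤o M₁ M₂ (M≤ b))
      f-close : ℚ.∣ f m ℚ.- f n ∣ ℚ.≤ δ C C>0 ε
      f-close = proj₂ (hf (δ C C>0 ε) (δ>0 C C>0 ε ε>0)) m n
        (ℕₚ.m⊔n≤o⇒m≤o (N₁ ε ε>0) (N₂ ε ε>0) (N≤ a)) (ℕₚ.m⊔n≤o⇒m≤o (N₁ ε ε>0) (N₂ ε ε>0) (N≤ b))
      g-close : ℚ.∣ g m ℚ.- g n ∣ ℚ.≤ δ B B>0 ε
      g-close = proj₂ (hg (δ B B>0 ε) (δ>0 B B>0 ε ε>0)) m n
        (ℕₚ.m⊔n≤o⇒n≤o (N₁ ε ε>0) (N₂ ε ε>0) (N≤ a)) (ℕₚ.m⊔n≤o⇒n≤o (N₁ ε ε>0) (N₂ ε ε>0) (N≤ b))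

-- ⌊log₂ rᵏ⌋ for rational r ≥ 1.
⌊log₂_^_⌋ : ℚ → ℕ → ℕ
⌊log₂ r ^ k ⌋ = ⌊log₂ ℤ.∣ floor (r ^ℚ k) ∣ ⌋

-- For r ≥ 1 this is ⌊(n + 1) log₂ r⌋ / (n + 1), hence within 1 / (n + 1) of log₂ r; smaller r are replaced by 1.
log₂≈ : ℚ → ℕ → ℚ
log₂≈ r n = + ⌊log₂ r ℚ.⊔ 1ℚ ^ suc n ⌋ / suc n

module LogLemmas where

  open CauchyLemmas
  open +-*-Solver using (solve; _:+_; _:*_; _:-_; :-_; con; _:=_)

  2ℚ : ℚ
  2ℚ = ι 2

  toℚᵘ-/ : ∀ m k → ℚ.toℚᵘ (+ m / suc k) ℚᵘ.≃ mkℚᵘ (+ m) k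
  toℚᵘ-/ m k = ℚₚ.toℚᵘ-fromℚᵘ (mkℚᵘ (+ m) k)

  /-mono-≤ : ∀ {m k n l} → m ℕ.* suc l ℕ.≤ n ℕ.* suc k → + m / suc k ℚ.≤ + n / suc l
  /-mono-≤ {m} {k} {n} {l} h = ℚₚ.toℚᵘ-cancel-≤ (begin
    ℚ.toℚᵘ (+ m / suc k)  ≃⟨ toℚᵘ-/ m k ⟩
    mkℚᵘ (+ m) k          ≤⟨ ℚᵘ.*≤* (subst₂ ℤ._≤_ (ℤₚ.pos-* m (suc l)) (ℤₚ.pos-* n (suc k)) (ℤ.+≤+ h)) ⟩
    mkℚᵘ (+ n) l          ≃⟨ toℚᵘ-/ n l ⟨
    ℚ.toℚᵘ (+ n / suc l)  ∎)
    where open ℚᵘₚ.≤-Reasoning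

  /-cancel-≤ : ∀ {m k n l} → + m / suc k ℚ.≤ + n / suc l → m ℕ.* suc l ℕ.≤ n ℕ.* suc k
  /-cancel-≤ {m} {k} {n} {l} h
    with ℚᵘₚ.≤-respˡ-≃ (toℚᵘ-/ m k) (ℚᵘₚ.≤-respʳ-≃ (toℚᵘ-/ n l) (ℚₚ.toℚᵘ-mono-≤ h))
  ... | ℚᵘ.*≤* le = ℤₚ.drop‿+≤+
          (subst₂ ℤ._≤_ (sym (ℤₚ.pos-* m (suc l))) (sym (ℤₚ.pos-* n (suc k))) le)

  /-homo-+ : ∀ m k n l →
    + (m ℕ.* suc l ℕ.+ n ℕ.* suc k) / (suc k ℕ.* suc l) ≡ + m / suc k ℚ.+ + n / suc l
  /-homo-+ m k n l = ℚₚ.toℚᵘ-injective (begin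
    ℚ.toℚᵘ (+ (m ℕ.* suc l ℕ.+ n ℕ.* suc k) / (suc k ℕ.* suc l))
      ≈⟨ toℚᵘ-/ (m ℕ.* suc l ℕ.+ n ℕ.* suc k) (l ℕ.+ k ℕ.* suc l) ⟩
    mkℚᵘ (+ (m ℕ.* suc l ℕ.+ n ℕ.* suc k)) (l ℕ.+ k ℕ.* suc l)
      ≡⟨ cong (λ z → mkℚᵘ z (l ℕ.+ k ℕ.* suc l))
           (trans (ℤₚ.pos-+ (m ℕ.* suc l) (n ℕ.* suc k)) (cong₂ ℤ._+_ (ℤₚ.pos-* m (suc l)) (ℤₚ.pos-* n (suc k)))) ⟩
    mkℚᵘ (+ m) k ℚᵘ.+ mkℚᵘ (+ n) l
      ≈⟨ ℚᵘₚ.+-cong (toℚᵘ-/ m k) (toℚᵘ-/ n l) ⟨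
    ℚ.toℚᵘ (+ m / suc k) ℚᵘ.+ ℚ.toℚᵘ (+ n / suc l)
      ≈⟨ ℚₚ.toℚᵘ-homo-+ (+ m / suc k) (+ n / suc l) ⟨
    ℚ.toℚᵘ (+ m / suc k ℚ.+ + n / suc l)  ∎)
    where open ℚᵘₚ.≃-Reasoning

  /-homo-* : ∀ m k n l → + (m ℕ.* n) / (suc k ℕ.* suc l) ≡ (+ m / suc k) ℚ.* (+ n / suc l)
  /-homo-* m k n l = ℚₚ.toℚᵘ-injective (begin
    ℚ.toℚᵘ (+ (m ℕ.* n) / (suc k ℕ.* suc l))
      ≈⟨ toℚᵘ-/ (m ℕ.* n) (l ℕ.+ k ℕ.* suc l) ⟩
    mkℚᵘ (+ (m ℕ.* n)) (l ℕ.+ k ℕ.* suc l)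
      ≡⟨ cong (λ z → mkℚᵘ z (l ℕ.+ k ℕ.* suc l)) (ℤₚ.pos-* m n) ⟩
    mkℚᵘ (+ m) k ℚᵘ.* mkℚᵘ (+ n) l
      ≈⟨ ℚᵘₚ.*-cong (toℚᵘ-/ m k) (toℚᵘ-/ n l) ⟨
    ℚ.toℚᵘ (+ m / suc k) ℚᵘ.* ℚ.toℚᵘ (+ n / suc l)
      ≈⟨ ℚₚ.toℚᵘ-homo-* (+ m / suc k) (+ n / suc l) ⟨
    ℚ.toℚᵘ ((+ m / suc k) ℚ.* (+ n / suc l))  ∎)
    where open ℚᵘₚ.≃-Reasoning

  ι-mono-≤ : ∀ {m n} → m ℕ.≤ n → ι m ℚ.≤ ι n
  ι-mono-≤ {m} {n} m≤n = /-mono-≤ {m} {0} {n} {0} (ℕₚ.*-monoˡ-≤ 1 m≤n)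

  ι-cancel-≤ : ∀ {m n} → ι m ℚ.≤ ι n → m ℕ.≤ n
  ι-cancel-≤ {m} {n} h = subst₂ ℕ._≤_ (ℕₚ.*-identityʳ m) (ℕₚ.*-identityʳ n)
    (/-cancel-≤ {m} {0} {n} {0} h)

  ι-homo-* : ∀ m n → ι (m ℕ.* n) ≡ ι m ℚ.* ι n
  ι-homo-* m n = /-homo-* m 0 n 0

  ι-suc : ∀ i → ι (suc i) ≡ 1ℚ ℚ.+ ι i
  ι-suc i = trans (cong (λ z → ι (suc z)) (sym (ℕₚ.*-identityʳ i))) (/-homo-+ 1 0 i 0)

  ι-2^ : ∀ k → ι (2 ℕ.^ k) ≡ 2ℚ ^ℚ k
  ι-2^ zero    = refl
  ι-2^ (suc k) = trans (ι-homo-* 2 (2 ℕ.^ k)) (cong (2ℚ ℚ.*_) (ι-2^ k))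

  ι-floor : ∀ r → 0ℚ ℚ.≤ r → ι ℤ.∣ floor r ∣ ℚ.≤ r × r ℚ.< ι (suc ℤ.∣ floor r ∣)
  ι-floor r@(mkℚ (-[1+ n ]) d _) (ℚ.*≤* ())
  ι-floor r@(mkℚ (+ n) d _) _ = lower , upper
    where
    t≡ : ℤ.∣ floor r ∣ ≡ n ℕ./ suc d
    t≡ = cong ℤ.∣_∣ (ℤₚ.*-identityˡ (+ (n ℕ./ suc d)))
    open ℚᵘₚ.≤-Reasoning
    lower : ι ℤ.∣ floor r ∣ ℚ.≤ r
    lower rewrite t≡ = ℚₚ.toℚᵘ-cancel-≤ (begin
      ℚ.toℚᵘ (ι (n ℕ./ suc d))  ≃⟨ ℚₚ.toℚᵘ-fromℚᵘ (mkℚᵘ (+ (n ℕ./ suc d)) 0) ⟩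
      mkℚᵘ (+ (n ℕ./ suc d)) 0  ≤⟨ ℚᵘ.*≤* (subst₂ ℤ._≤_ (ℤₚ.pos-* (n ℕ./ suc d) (suc d))
                                       (sym (ℤₚ.*-identityʳ (+ n))) (ℤ.+≤+ (ℕd.m/n*n≤m n (suc d)))) ⟩
      mkℚᵘ (+ n) d              ∎)
    upper : r ℚ.< ι (suc ℤ.∣ floor r ∣)
    upper rewrite t≡ = ℚₚ.toℚᵘ-cancel-< (begin-strict
      mkℚᵘ (+ n) d                    <⟨ ℚᵘ.*<* (subst₂ ℤ._<_ (sym (ℤₚ.*-identityʳ (+ n)))
                                          (ℤₚ.pos-* (suc (n ℕ./ suc d)) (suc d)) (ℤ.+<+ n<)) ⟩
      mkℚᵘ (+ suc (n ℕ./ suc d)) 0    ≃⟨ ℚₚ.toℚᵘ-fromℚᵘ (mkℚᵘ (+ suc (n ℕ./ suc d)) 0) ⟨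
      ℚ.toℚᵘ (ι (suc (n ℕ./ suc d)))  ∎)
      where
      n< : n ℕ.< suc (n ℕ./ suc d) ℕ.* suc d
      n< = subst (ℕ._< suc (n ℕ./ suc d) ℕ.* suc d) (sym (ℕd.m≡m%n+[m/n]*n n (suc d)))
             (ℕₚ.+-monoˡ-< ((n ℕ./ suc d) ℕ.* suc d) (ℕd.m%n<n n (suc d)))

  2^⌊log₂⌋≤ : ∀ n → 0 ℕ.< n → 2 ℕ.^ ⌊log₂ n ⌋ ℕ.≤ n
  2^⌊log₂⌋≤ = <-rec _ λ n rec 0<n → go n rec 0<n ⌊log₂ n ⌋ refl
    where
    2*⌊n/2⌋≤n : ∀ n → 2 ℕ.* ℕ.⌊ n /2⌋ ℕ.≤ n
    2*⌊n/2⌋≤n n = subst₂ ℕ._≤_ (cong (ℕ.⌊ n /2⌋ ℕ.+_) (sym (ℕₚ.+-identityʳ ℕ.⌊ n /2⌋)))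
      (ℕₚ.⌊n/2⌋+⌈n/2⌉≡n n) (ℕₚ.+-monoʳ-≤ ℕ.⌊ n /2⌋ (ℕₚ.⌊n/2⌋≤⌈n/2⌉ n))

    go : ∀ n → (∀ {m} → m ℕ.< n → 0 ℕ.< m → 2 ℕ.^ ⌊log₂ m ⌋ ℕ.≤ m) →
         0 ℕ.< n → ∀ k → ⌊log₂ n ⌋ ≡ k → 2 ℕ.^ k ℕ.≤ n
    go n             rec 0<n zero    _  = 0<n
    go 1             rec _   (suc k) ()
    go (suc (suc n)) rec _   (suc k) e  =
      ℕₚ.≤-trans (ℕₚ.*-monoʳ-≤ 2 ih) (2*⌊n/2⌋≤n (suc (suc n)))
      where
      ih : 2 ℕ.^ k ℕ.≤ ℕ.⌊ suc (suc n) /2⌋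
      ih = subst (λ z → 2 ℕ.^ z ℕ.≤ ℕ.⌊ suc (suc n) /2⌋)
             (trans (⌊log₂⌊n/2⌋⌋≡⌊log₂n⌋∸1 (suc (suc n))) (cong ℕ.pred e))
             (rec (ℕₚ.⌊n/2⌋<n (suc n)) (s≤s z≤n))

  <2^1+⌊log₂⌋ : ∀ n → n ℕ.< 2 ℕ.^ suc ⌊log₂ n ⌋
  <2^1+⌊log₂⌋ n = ℕₚ.≰⇒> λ h → ℕₚ.1+n≰n
    (subst (ℕ._≤ ⌊log₂ n ⌋) (⌊log₂[2^n]⌋≡n (suc ⌊log₂ n ⌋)) (⌊log₂⌋-mono-≤ h))

  0≤1 : 0ℚ ℚ.≤ 1ℚ
  0≤1 = ℚₚ.nonNegative⁻¹ 1ℚ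

  *-mono-≤ : ∀ {p q r s} → 0ℚ ℚ.≤ p → 0ℚ ℚ.≤ s → p ℚ.≤ q → r ℚ.≤ s → p ℚ.* r ℚ.≤ q ℚ.* s
  *-mono-≤ {p} {q} {r} {s} 0≤p 0≤s p≤q r≤s = ℚₚ.≤-trans
    (ℚₚ.*-monoˡ-≤-nonNeg p {{ℚ.nonNegative 0≤p}} r≤s)
    (ℚₚ.*-monoʳ-≤-nonNeg s {{ℚ.nonNegative 0≤s}} p≤q)

  ^-nonNeg : ∀ {p} k → 0ℚ ℚ.≤ p → 0ℚ ℚ.≤ p ^ℚ k
  ^-nonNeg zero    _   = 0≤1
  ^-nonNeg {p} (suc k) 0≤p = subst (ℚ._≤ p ℚ.* p ^ℚ k) (ℚₚ.*-zeroˡ 0ℚ)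
    (*-mono-≤ ℚₚ.≤-refl (^-nonNeg k 0≤p) 0≤p (^-nonNeg k 0≤p))

  ^-mono-≤ : ∀ {p q} k → 0ℚ ℚ.≤ p → p ℚ.≤ q → p ^ℚ k ℚ.≤ q ^ℚ k
  ^-mono-≤ zero    _   _   = ℚₚ.≤-refl
  ^-mono-≤ (suc k) 0≤p p≤q =
    *-mono-≤ 0≤p (^-nonNeg k (ℚₚ.≤-trans 0≤p p≤q)) p≤q (^-mono-≤ k 0≤p p≤q)

  1≤^ : ∀ {p} k → 1ℚ ℚ.≤ p → 1ℚ ℚ.≤ p ^ℚ k
  1≤^ zero    _   = ℚₚ.≤-refl
  1≤^ (suc k) 1≤p = *-mono-≤ 0≤1 (^-nonNeg k (ℚₚ.≤-trans 0≤1 1≤p)) 1≤p (1≤^ k 1≤p)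

  2^-cancel-≤ : ∀ a b → 2ℚ ^ℚ a ℚ.≤ 2ℚ ^ℚ b → a ℕ.≤ b
  2^-cancel-≤ a b h = subst₂ ℕ._≤_ (⌊log₂[2^n]⌋≡n a) (⌊log₂[2^n]⌋≡n b)
    (⌊log₂⌋-mono-≤ (ι-cancel-≤ {2 ℕ.^ a} {2 ℕ.^ b}
      (subst₂ ℚ._≤_ (sym (ι-2^ a)) (sym (ι-2^ b)) h)))

  ∣floor∣>0 : ∀ r → 1ℚ ℚ.≤ r → 0 ℕ.< ℤ.∣ floor r ∣
  ∣floor∣>0 r 1≤r = go ℤ.∣ floor r ∣ (proj₂ (ι-floor r (ℚₚ.≤-trans 0≤1 1≤r)))
    where
    go : ∀ t → r ℚ.< ι (suc t) → 0 ℕ.< t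
    go zero    r<1 = ⊥-elim (ℚₚ.<-irrefl refl (ℚₚ.≤-<-trans 1≤r r<1))
    go (suc _) _   = s≤s z≤n

  lower : ∀ r k → 1ℚ ℚ.≤ r → 2ℚ ^ℚ ⌊log₂ r ^ k ⌋ ℚ.≤ r ^ℚ k
  lower r k 1≤r = begin
    2ℚ ^ℚ ⌊log₂ r ^ k ⌋       ≡⟨ ι-2^ ⌊log₂ r ^ k ⌋ ⟨
    ι (2 ℕ.^ ⌊log₂ r ^ k ⌋)   ≤⟨ ι-mono-≤ (2^⌊log₂⌋≤ t (∣floor∣>0 (r ^ℚ k) (1≤^ k 1≤r))) ⟩
    ι t                       ≤⟨ proj₁ (ι-floor (r ^ℚ k) (^-nonNeg k (ℚₚ.≤-trans 0≤1 1≤r))) ⟩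
    r ^ℚ k                    ∎
    where
    open ℚₚ.≤-Reasoning
    t = ℤ.∣ floor (r ^ℚ k) ∣

  upper : ∀ r k → 1ℚ ℚ.≤ r → r ^ℚ k ℚ.≤ 2ℚ ^ℚ suc ⌊log₂ r ^ k ⌋
  upper r k 1≤r = begin
    r ^ℚ k                       ≤⟨ ℚₚ.<⇒≤ (proj₂ (ι-floor (r ^ℚ k) (^-nonNeg k (ℚₚ.≤-trans 0≤1 1≤r)))) ⟩
    ι (suc t)                    ≤⟨ ι-mono-≤ (<2^1+⌊log₂⌋ t) ⟩
    ι (2 ℕ.^ suc ⌊log₂ r ^ k ⌋)  ≡⟨ ι-2^ (suc ⌊log₂ r ^ k ⌋) ⟩
    2ℚ ^ℚ suc ⌊log₂ r ^ k ⌋      ∎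
    where
    open ℚₚ.≤-Reasoning
    t = ℤ.∣ floor (r ^ℚ k) ∣

  -- If r ≤ s u and u ᴷ ≤ 2 then log₂ r ≤ log₂ s + 1 / K, up to rounding.
  compare : ∀ r s u M N K → 1ℚ ℚ.≤ r → 1ℚ ℚ.≤ s → 0ℚ ℚ.≤ u → r ℚ.≤ s ℚ.* u → u ^ℚ K ℚ.≤ 2ℚ →
            ⌊log₂ r ^ M ⌋ ℕ.* (N ℕ.* K) ℕ.≤ (suc ⌊log₂ s ^ N ⌋ ℕ.* K ℕ.+ 1 ℕ.* N) ℕ.* M
  compare r s u M N K 1≤r 1≤s 0≤u r≤su uᴷ≤2 = 2^-cancel-≤ _ _ (begin
    2ℚ ^ℚ (A ℕ.* (N ℕ.* K))                                ≡⟨ E.^-assocʳ 2ℚ A (N ℕ.* K) ⟨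
    (2ℚ ^ℚ A) ^ℚ (N ℕ.* K)                                 ≤⟨ ^-mono-≤ (N ℕ.* K) (^-nonNeg A 0≤2) (lower r M 1≤r) ⟩
    (r ^ℚ M) ^ℚ (N ℕ.* K)                                  ≤⟨ ^-mono-≤ (N ℕ.* K) (^-nonNeg M (ℚₚ.≤-trans 0≤1 1≤r)) (^-mono-≤ M (ℚₚ.≤-trans 0≤1 1≤r) r≤su) ⟩
    ((s ℚ.* u) ^ℚ M) ^ℚ (N ℕ.* K)                          ≡⟨ E.^-assocʳ (s ℚ.* u) M (N ℕ.* K) ⟩
    (s ℚ.* u) ^ℚ (M ℕ.* (N ℕ.* K))                         ≡⟨ E.^-distrib-* s u (M ℕ.* (N ℕ.* K)) ⟩
    s ^ℚ (M ℕ.* (N ℕ.* K)) ℚ.* u ^ℚ (M ℕ.* (N ℕ.* K))      ≡⟨ cong₂ ℚ._*_ (cong (s ^ℚ_) e₁) (cong (u ^ℚ_) e₂) ⟩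
    s ^ℚ (N ℕ.* (K ℕ.* M)) ℚ.* u ^ℚ (K ℕ.* (1 ℕ.* N ℕ.* M))
      ≡⟨ cong₂ ℚ._*_ (E.^-assocʳ s N (K ℕ.* M)) (E.^-assocʳ u K (1 ℕ.* N ℕ.* M)) ⟨
    (s ^ℚ N) ^ℚ (K ℕ.* M) ℚ.* (u ^ℚ K) ^ℚ (1 ℕ.* N ℕ.* M)
      ≤⟨ *-mono-≤ (^-nonNeg (K ℕ.* M) (^-nonNeg N 0≤s)) (^-nonNeg (1 ℕ.* N ℕ.* M) 0≤2)
           (^-mono-≤ (K ℕ.* M) (^-nonNeg N 0≤s) (upper s N 1≤s))
           (^-mono-≤ (1 ℕ.* N ℕ.* M) (^-nonNeg K 0≤u) uᴷ≤2) ⟩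
    (2ℚ ^ℚ suc B) ^ℚ (K ℕ.* M) ℚ.* 2ℚ ^ℚ (1 ℕ.* N ℕ.* M)
      ≡⟨ cong (ℚ._* 2ℚ ^ℚ (1 ℕ.* N ℕ.* M)) (E.^-assocʳ 2ℚ (suc B) (K ℕ.* M)) ⟩
    2ℚ ^ℚ (suc B ℕ.* (K ℕ.* M)) ℚ.* 2ℚ ^ℚ (1 ℕ.* N ℕ.* M)  ≡⟨ E.^-homo-* 2ℚ (suc B ℕ.* (K ℕ.* M)) (1 ℕ.* N ℕ.* M) ⟨
    2ℚ ^ℚ (suc B ℕ.* (K ℕ.* M) ℕ.+ 1 ℕ.* N ℕ.* M)          ≡⟨ cong (2ℚ ^ℚ_) e₃ ⟨
    2ℚ ^ℚ ((suc B ℕ.* K ℕ.+ 1 ℕ.* N) ℕ.* M)                ∎)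
    where
    open ℚₚ.≤-Reasoning
    A = ⌊log₂ r ^ M ⌋
    B = ⌊log₂ s ^ N ⌋
    0≤2 : 0ℚ ℚ.≤ 2ℚ
    0≤2 = ℚₚ.nonNegative⁻¹ 2ℚ
    0≤s : 0ℚ ℚ.≤ s
    0≤s = ℚₚ.≤-trans 0≤1 1≤s
    e₁ : M ℕ.* (N ℕ.* K) ≡ N ℕ.* (K ℕ.* M)
    e₁ = trans (ℕₚ.*-comm M (N ℕ.* K)) (ℕₚ.*-assoc N K M)
    e₂ : M ℕ.* (N ℕ.* K) ≡ K ℕ.* (1 ℕ.* N ℕ.* M)
    e₂ = trans (sym (ℕₚ.*-assoc M N K)) (trans (ℕₚ.*-comm (M ℕ.* N) K)
           (cong (K ℕ.*_) (trans (ℕₚ.*-comm M N) (cong (ℕ._* M) (sym (ℕₚ.*-identityˡ N))))))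
    e₃ : (suc B ℕ.* K ℕ.+ 1 ℕ.* N) ℕ.* M ≡ suc B ℕ.* (K ℕ.* M) ℕ.+ 1 ℕ.* N ℕ.* M
    e₃ = trans (ℕₚ.*-distribʳ-+ M (suc B ℕ.* K) (1 ℕ.* N))
           (cong (ℕ._+ 1 ℕ.* N ℕ.* M) (ℕₚ.*-assoc (suc B) K M))

  1/suc : ℕ → ℚ
  1/suc k = + 1 / suc k

  1/suc>0 : ∀ k → 0ℚ ℚ.< 1/suc k
  1/suc>0 k = ℚₚ.positive⁻¹ (1/suc k) {{ℚₚ.normalize-pos 1 (suc k)}}

  1/suc-mono : ∀ {k n} → k ℕ.≤ n → 1/suc n ℚ.≤ 1/suc k
  1/suc-mono {k} {n} k≤n = /-mono-≤ {1} {n} {1} {k} (ℕₚ.*-monoʳ-≤ 1 (s≤s k≤n))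

  archimedean : ∀ ε → 0ℚ ℚ.< ε → ∃[ k ] 1/suc k ℚ.≤ ε
  archimedean (mkℚ (+ zero) d _) (ℚ.*<* 0<0) = ⊥-elim (ℤₚ.<-irrefl refl 0<0)
  archimedean (mkℚ (-[1+ _ ]) d _) (ℚ.*<* ())
  archimedean ε@(mkℚ (+ suc n) d _) _ = d , ℚₚ.toℚᵘ-cancel-≤ (begin
    ℚ.toℚᵘ (1/suc d)   ≃⟨ toℚᵘ-/ 1 d ⟩
    mkℚᵘ (+ 1) d       ≤⟨ ℚᵘ.*≤* (ℤₚ.*-monoʳ-≤-nonNeg (+ suc d) {+ 1} {+ suc n} (ℤ.+≤+ (s≤s z≤n))) ⟩
    mkℚᵘ (+ suc n) d   ∎)
    where open ℚᵘₚ.≤-Reasoning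

  i/suc≤1 : ∀ k i → i ℕ.≤ suc k → ι i ℚ.* 1/suc k ℚ.≤ 1ℚ
  i/suc≤1 k i i≤ = subst (ℚ._≤ 1ℚ) (/-homo-* i 0 1 k)
    (/-mono-≤ {i ℕ.* 1} {k ℕ.+ 0} {1} {0}
      (subst₂ ℕ._≤_ (sym (trans (ℕₚ.*-identityʳ _) (ℕₚ.*-identityʳ i)))
        (sym (trans (ℕₚ.*-identityˡ _) (cong suc (ℕₚ.+-identityʳ k)))) i≤))

  u : ℕ → ℚ
  u k = 1ℚ ℚ.+ ½ ℚ.* 1/suc k

  0≤u : ∀ k → 0ℚ ℚ.≤ u k
  0≤u k = ℚₚ.<⇒≤ (ℚₚ.+-mono-< (ℚₚ.positive⁻¹ 1ℚ) (half _ (1/suc>0 k)))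

  u^≤ : ∀ k i → i ℕ.≤ suc k → u k ^ℚ i ℚ.≤ 1ℚ ℚ.+ ι i ℚ.* 1/suc k
  u^≤ k zero    _  = ℚₚ.≤-reflexive (sym (trans (cong (1ℚ ℚ.+_) (ℚₚ.*-zeroˡ (1/suc k))) (ℚₚ.+-identityʳ 1ℚ)))
  u^≤ k (suc i) i< = begin
    u k ℚ.* u k ^ℚ i                      ≤⟨ ℚₚ.*-monoˡ-≤-nonNeg (u k) {{ℚ.nonNegative (0≤u k)}} (u^≤ k i i≤) ⟩
    (1ℚ ℚ.+ h) ℚ.* (1ℚ ℚ.+ t)             ≡⟨ expand h t ⟩
    (1ℚ ℚ.+ h ℚ.+ t) ℚ.+ h ℚ.* t          ≤⟨ ℚₚ.+-monoʳ-≤ (1ℚ ℚ.+ h ℚ.+ t)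
                                               (ℚₚ.*-monoˡ-≤-nonNeg h {{ℚ.nonNegative (ℚₚ.<⇒≤ (half η (1/suc>0 k)))}} (i/suc≤1 k i i≤)) ⟩
    (1ℚ ℚ.+ h ℚ.+ t) ℚ.+ h ℚ.* 1ℚ         ≡⟨ collect h t ⟩
    1ℚ ℚ.+ ((h ℚ.+ h) ℚ.+ t)              ≡⟨ cong (λ z → 1ℚ ℚ.+ (z ℚ.+ t)) (halves η) ⟩
    1ℚ ℚ.+ (η ℚ.+ t)                      ≡⟨ cong (1ℚ ℚ.+_) (factor η (ι i)) ⟩
    1ℚ ℚ.+ (1ℚ ℚ.+ ι i) ℚ.* η             ≡⟨ cong (λ z → 1ℚ ℚ.+ z ℚ.* η) (ι-suc i) ⟨
    1ℚ ℚ.+ ι (suc i) ℚ.* η                ∎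
    where
    open ℚₚ.≤-Reasoning
    i≤ = ℕₚ.<⇒≤ i<
    η = 1/suc k
    h = ½ ℚ.* η
    t = ι i ℚ.* η
    expand : ∀ h t → (1ℚ ℚ.+ h) ℚ.* (1ℚ ℚ.+ t) ≡ (1ℚ ℚ.+ h ℚ.+ t) ℚ.+ h ℚ.* t
    expand = solve 2 (λ h t → (con 1ℚ :+ h) :* (con 1ℚ :+ t) := (con 1ℚ :+ h :+ t) :+ h :* t) refl
    collect : ∀ h t → (1ℚ ℚ.+ h ℚ.+ t) ℚ.+ h ℚ.* 1ℚ ≡ 1ℚ ℚ.+ ((h ℚ.+ h) ℚ.+ t)
    collect = solve 2 (λ h t → (con 1ℚ :+ h :+ t) :+ h :* con 1ℚ := con 1ℚ :+ ((h :+ h) :+ t)) refl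
    factor : ∀ e i → e ℚ.+ i ℚ.* e ≡ (1ℚ ℚ.+ i) ℚ.* e
    factor = solve 2 (λ e i → e :+ i :* e := (con 1ℚ :+ i) :* e) refl

  uᴷ≤2 : ∀ k → u k ^ℚ suc k ℚ.≤ 2ℚ
  uᴷ≤2 k = ℚₚ.≤-trans (u^≤ k (suc k) ℕₚ.≤-refl) (ℚₚ.+-monoʳ-≤ 1ℚ (i/suc≤1 k (suc k) ℕₚ.≤-refl))

  close : ∀ p q k → p ℚ.- q ℚ.≤ ½ ℚ.* 1/suc k → p ℚ.⊔ 1ℚ ℚ.≤ (q ℚ.⊔ 1ℚ) ℚ.* u k
  close p q k p-q≤h = begin
    p ℚ.⊔ 1ℚ         ≤⟨ ℚₚ.⊔-lub p≤s+h 1≤s+h ⟩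
    s ℚ.+ h          ≡⟨ cong (s ℚ.+_) (ℚₚ.*-identityˡ h) ⟨
    s ℚ.+ 1ℚ ℚ.* h   ≤⟨ ℚₚ.+-monoʳ-≤ s (ℚₚ.*-monoʳ-≤-nonNeg h {{ℚ.nonNegative 0≤h}} 1≤s) ⟩
    s ℚ.+ s ℚ.* h    ≡⟨ factor s h ⟩
    s ℚ.* u k        ∎
    where
    open ℚₚ.≤-Reasoning
    s = q ℚ.⊔ 1ℚ
    h = ½ ℚ.* 1/suc k
    0≤h : 0ℚ ℚ.≤ h
    0≤h = ℚₚ.<⇒≤ (half _ (1/suc>0 k))
    1≤s : 1ℚ ℚ.≤ s
    1≤s = ℚₚ.p≤q⊔p q 1ℚ
    factor : ∀ s h → s ℚ.+ s ℚ.* h ≡ s ℚ.* (1ℚ ℚ.+ h)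
    factor = solve 2 (λ s h → s :+ s :* h := s :* (con 1ℚ :+ h)) refl
    restore : ∀ a b → b ℚ.+ (a ℚ.- b) ≡ a
    restore = solve 2 (λ a b → b :+ (a :- b) := a) refl
    p≤s+h : p ℚ.≤ s ℚ.+ h
    p≤s+h = subst (ℚ._≤ s ℚ.+ h) (restore p q) (ℚₚ.+-mono-≤ (ℚₚ.p≤p⊔q q 1ℚ) p-q≤h)
    1≤s+h : 1ℚ ℚ.≤ s ℚ.+ h
    1≤s+h = subst (ℚ._≤ s ℚ.+ h) (ℚₚ.+-identityʳ 1ℚ) (ℚₚ.+-mono-≤ 1≤s 0≤h)

  log₂≈-close : ∀ p q m n k → p ℚ.- q ℚ.≤ ½ ℚ.* 1/suc k →
                log₂≈ p m ℚ.≤ (log₂≈ q n ℚ.+ 1/suc n) ℚ.+ 1/suc k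
  log₂≈-close p q m n k h = begin
    + A / suc m
      ≤⟨ /-mono-≤ {A} {m} {suc B ℕ.* suc k ℕ.+ 1 ℕ.* suc n} {k ℕ.+ n ℕ.* suc k}
           (compare (p ℚ.⊔ 1ℚ) (q ℚ.⊔ 1ℚ) (u k) (suc m) (suc n) (suc k)
             (ℚₚ.p≤q⊔p p 1ℚ) (ℚₚ.p≤q⊔p q 1ℚ) (0≤u k) (close p q k h) (uᴷ≤2 k)) ⟩
    + (suc B ℕ.* suc k ℕ.+ 1 ℕ.* suc n) / (suc n ℕ.* suc k)
      ≡⟨ /-homo-+ (suc B) n 1 k ⟩
    + suc B / suc n ℚ.+ 1/suc k
      ≤⟨ ℚₚ.+-monoˡ-≤ (1/suc k) (/-mono-≤ {suc B} {n} {B ℕ.* suc n ℕ.+ 1 ℕ.* suc n} {n ℕ.+ n ℕ.* suc n}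
           (ℕₚ.≤-reflexive split)) ⟩
    + (B ℕ.* suc n ℕ.+ 1 ℕ.* suc n) / (suc n ℕ.* suc n) ℚ.+ 1/suc k
      ≡⟨ cong (ℚ._+ 1/suc k) (/-homo-+ B n 1 n) ⟩
    (+ B / suc n ℚ.+ 1/suc n) ℚ.+ 1/suc k ∎
    where
    open ℚₚ.≤-Reasoning
    A = ⌊log₂ p ℚ.⊔ 1ℚ ^ suc m ⌋
    B = ⌊log₂ q ℚ.⊔ 1ℚ ^ suc n ⌋
    split : suc B ℕ.* (suc n ℕ.* suc n) ≡ (B ℕ.* suc n ℕ.+ 1 ℕ.* suc n) ℕ.* suc n
    split = trans (sym (ℕₚ.*-assoc (suc B) (suc n) (suc n)))
      (cong (ℕ._* suc n) (trans (ℕₚ.+-comm (suc n) (B ℕ.* suc n))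
        (cong (B ℕ.* suc n ℕ.+_) (sym (ℕₚ.*-identityˡ (suc n))))))

  log-cauchy : ∀ {f} → IsCauchy f → IsCauchy (λ n → log₂≈ (f n) n)
  log-cauchy {f} hf = fromOneSided {λ n → log₂≈ (f n) n} λ ε ε>0 →
    let (k , η≤) = archimedean (½ ℚ.* ε) (half ε ε>0)
        (N , h)  = toOneSided {f} hf (½ ℚ.* 1/suc k) (half (1/suc k) (1/suc>0 k))
    in N ℕ.⊔ k , λ m n a b →
      bound ε k η≤ m n (h m n (ℕₚ.m⊔n≤o⇒m≤o N k a) (ℕₚ.m⊔n≤o⇒m≤o N k b)) (ℕₚ.m⊔n≤o⇒n≤o N k b)
    where
    shift : ∀ a b c → ((a ℚ.+ b) ℚ.+ c) ℚ.- a ≡ b ℚ.+ c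
    shift = solve 3 (λ a b c → ((a :+ b) :+ c) :- a := b :+ c) refl

    bound : ∀ ε k → 1/suc k ℚ.≤ ½ ℚ.* ε → ∀ m n → f m ℚ.- f n ℚ.≤ ½ ℚ.* 1/suc k →
            k ℕ.≤ n → log₂≈ (f m) m ℚ.- log₂≈ (f n) n ℚ.≤ ε
    bound ε k η≤ m n h k≤n = begin
      log₂≈ (f m) m ℚ.- log₂≈ (f n) n
        ≤⟨ ℚₚ.+-monoˡ-≤ (ℚ.- log₂≈ (f n) n) (log₂≈-close (f m) (f n) m n k h) ⟩
      ((log₂≈ (f n) n ℚ.+ 1/suc n) ℚ.+ 1/suc k) ℚ.- log₂≈ (f n) n
        ≡⟨ shift (log₂≈ (f n) n) (1/suc n) (1/suc k) ⟩
      1/suc n ℚ.+ 1/suc k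
        ≤⟨ ℚₚ.+-mono-≤ {1/suc n} {½ ℚ.* ε} {1/suc k} {½ ℚ.* ε}
             (ℚₚ.≤-trans (1/suc-mono k≤n) η≤) η≤ ⟩
      ½ ℚ.* ε ℚ.+ ½ ℚ.* ε
        ≡⟨ halves ε ⟩
      ε ∎
      where open ℚₚ.≤-Reasoning

infix  4 _≃_ _≤_ _<_
infixl 6 _+_ _-_
infixl 7 _*_
infix  8 -_

_≃_ : ℝ → ℝ → Set
x ≃ y = ∀ ε → 0ℚ ℚ.< ε → Eventually (λ n → ℚ.∣ seq x n ℚ.- seq y n ∣ ℚ.≤ ε)

_≤_ : ℝ → ℝ → Set
x ≤ y = ∀ ε → 0ℚ ℚ.< ε → Eventually (λ n → seq x n ℚ.≤ seq y n ℚ.+ ε)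

_<_ : ℝ → ℝ → Set
x < y = ∃[ ε ] 0ℚ ℚ.< ε × Eventually (λ n → seq x n ℚ.+ ε ℚ.≤ seq y n)

fromℚ : ℚ → ℝ
fromℚ q = mkℝ (λ _ → q) (CauchyLemmas.const q)

fromℕ : ℕ → ℝ
fromℕ n = fromℚ (ι n)

0ℝ 1ℝ : ℝ
0ℝ = fromℚ 0ℚ
1ℝ = fromℚ 1ℚ

_+_ _*_ : ℝ → ℝ → ℝ
x + y = mkℝ (λ n → seq x n ℚ.+ seq y n) (CauchyLemmas.add {seq x} {seq y} (cauchy x) (cauchy y))
x * y = mkℝ (λ n → seq x n ℚ.* seq y n) (CauchyLemmas.mul {seq x} {seq y} (cauchy x) (cauchy y))

-_ : ℝ → ℝ
- x = mkℝ (λ n → ℚ.- seq x n) (CauchyLemmas.neg {seq x} (cauchy x))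

_-_ : ℝ → ℝ → ℝ
x - y = x + (- y)

∣_∣ : ℝ → ℝ
∣ x ∣ = mkℝ (λ n → ℚ.∣ seq x n ∣) (CauchyLemmas.abs {seq x} (cauchy x))

-- The binary logarithm of max(x, 1).  In Ω(n³ log log n) the truncation only
-- affects n < 2, and the base of the logarithms only the implied constant.
log₂ : ℝ → ℝ
log₂ x = mkℝ (λ n → log₂≈ (seq x n) n) (LogLemmas.log-cauchy {seq x} (cauchy x))

record ℝ³ : Set where
  constructor ⟨_,_,_⟩
  field
    x y z : ℝ

infix 4 _≃³_
_≃³_ : ℝ³ → ℝ³ → Set
⟨ x , y , z ⟩ ≃³ ⟨ x′ , y′ , z′ ⟩ = x ≃ x′ × y ≃ y′ × z ≃ z′

_-³_ : ℝ³ → ℝ³ → ℝ³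
⟨ x , y , z ⟩ -³ ⟨ x′ , y′ , z′ ⟩ = ⟨ x - x′ , y - y′ , z - z′ ⟩

det : ℝ³ → ℝ³ → ℝ³ → ℝ
det ⟨ a₁ , a₂ , a₃ ⟩ ⟨ b₁ , b₂ , b₃ ⟩ ⟨ c₁ , c₂ , c₃ ⟩ =
  a₁ * (b₂ * c₃ - b₃ * c₂) - a₂ * (b₁ * c₃ - b₃ * c₁) + a₃ * (b₁ * c₂ - b₂ * c₁)

volume : (p q r s : ℝ³) → ℝ
volume p q r s = fromℚ (+ 1 / 6) * ∣ det (q -³ p) (r -³ p) (s -³ p) ∣

-- A 4-element set of indices is represented by its increasing enumeration, so
-- that each tetrahedron is counted once.
UnitTetrahedron : ∀ {n} → (Fin n → ℝ³) → Fin n × Fin n × Fin n × Fin n → Set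
UnitTetrahedron p (i , j , k , l) =
  i Fin.< j × j Fin.< k × k Fin.< l × volume (p i) (p j) (p k) (p l) ≃ 1ℝ

HasCardinality : {A : Set} → (A → Set) → ℕ → Set
HasCardinality {A} P t =
  ∃[ xs ] Unique {A = A} xs × (∀ a → a ∈ xs ⇔ P a) × length xs ≡ t

{-# OPTIONS --safe #-}
module Submission where

-- A tetrahedron spanned by a segment (u, x) in the plane z = 0 and a segment (v, y) in the
-- plane z = 6 / D has volume |u y - v x| / D, wherever the two segments lie. Put in each plane
-- a grid of 2a columns and about n / 4a rows, and let D = a!. For 1 ≤ u, v ≤ a the gcd of u and
-- v divides D, so u y - v x = D has about n gcd(u, v) / a² solutions (x, y) of the size of the
-- grid. The mean of gcd(u, v) over u, v ≤ a is of order log a, and a! ≤ n allows log a to be of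
-- order log log n. The pairs of segments of determinant D thus number about n log log n, and
-- each has about n² pairs of positions.

open import Data.Nat.Base as ℕ using (ℕ; _^_)
open import Data.Fin.Base using (Fin)
open import Data.Product.Base using (_×_; ∃-syntax)
open import Function.Definitions using (Injective)
open import Relation.Binary.PropositionalEquality using (_≡_)

open import Data.Empty using (⊥-elim)
open import Data.List.Base using (List; []; _∷_; _++_; map; length; upTo; filter; allFin; cartesianProduct)
open import Data.List.Properties using (length-map; length-++; length-upTo)
open import Data.List.Membership.Propositional using (_∈_)
open import Data.List.Membership.Propositional.Properties
  using ( ∈-∃++; ∈-++⁺ˡ; ∈-++⁺ʳ; ∈-++⁻; ∈-map⁺; ∈-map⁻; ∈-upTo⁺; ∈-upTo⁻; ∈-filter⁺; ∈-filter⁻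
        ; ∈-cartesianProduct⁺; ∈-cartesianProduct⁻; ∈-allFin)
open import Data.List.Relation.Unary.All as All using (All; []; _∷_)
import Data.List.Relation.Unary.All.Properties as Allₚ
open import Data.List.Relation.Unary.AllPairs using ([]; _∷_)
open import Data.List.Relation.Unary.Any using (here; there)
open import Data.List.Relation.Unary.Unique.Propositional using (Unique)
open import Data.List.Relation.Unary.Unique.Propositional.Properties
  using (map⁺; ++⁺; upTo⁺; filter⁺; cartesianProduct⁺; allFin⁺)
open import Data.Product.Base using (_,_; proj₁; proj₂)
open import Data.Product.Properties using (,-injectiveʳ)
open import Data.Sum.Base using (inj₁; inj₂)
open import Function.Base using (_∘_)
open import Relation.Binary.Definitions using (tri<; tri≈; tri>)
open import Relation.Binary.PropositionalEquality
  using (refl; sym; trans; cong; cong₂; subst; subst₂; module ≡-Reasoning)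
open import Relation.Nullary using (¬_; yes; no; does; contradiction; ¬?)
open import Relation.Unary using (Decidable)

-- D has two opposed tasks. One value must be divisible by gcd(u, v) for all u, v ≤ a, because all
-- tetrahedra use the same two planes; and it must be small, because a solution of p y = q x + D / g
-- has to fit into the b = L a rows. The factorial settles the first. The second amounts to 32 a² a!
-- ≤ n, which confines a to a power of log n and so limits the gain to log log n. Only lower bounds
-- are counted, as lists of distinct witnesses. The exact number of unit tetrahedra that the
-- statement asks for exists because all coordinates are constant rational sequences, which makes
-- unit volume decidable.

module Combinatorics where

  open import Defs using (module LogLemmas)
  open import Data.Nat.Base using (zero; suc; _+_; _*_; _∸_; _≤_; _<_; z≤n; s≤s; NonZero; _!; >-nonZero)
  open import Data.Nat.Properties
  open import Data.Nat.DivMod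
    using (_/_; _%_; /-monoˡ-≤; m*n/n≡m; m/n*n≤m; m%n<n; m≡m%n+[m/n]*n)
  open import Data.Nat.Divisibility using (_∣_; divides; m∣m*n; ∣-trans; m≤n⇒m!∣n!)
  open import Data.Nat.GCD using (gcd; gcd[m,n]∣m; gcd[m,n]∣n; c*gcd[m,n]≡gcd[cm,cn]; module Bézout)
  open import Data.Nat.Coprimality
    using (Coprime; coprime?; gcd≡1⇒coprime; coprime⇒gcd≡1; coprime-Bézout)
  open import Data.Nat.Logarithm using (⌊log₂_⌋; ⌊log₂⌋-mono-≤; ⌊log₂[2^n]⌋≡n)
  open import Data.Nat.Tactic.RingSolver using (solve-∀)

  -- Lower bounds by lists of distinct witnesses

  private variable
    A B : Set
    P Q : A → Set
    k l : ℕ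

  unique-⊆⇒length≤ : {xs ys : List A} → Unique xs → (∀ {x} → x ∈ xs → x ∈ ys) →
                     length xs ≤ length ys
  unique-⊆⇒length≤ []          xs⊆ys = z≤n
  unique-⊆⇒length≤ {xs = x ∷ xs} (x∉xs ∷ uxs) xs⊆ys with ∈-∃++ (xs⊆ys (here refl))
  ... | as , bs , refl = begin
    suc (length xs)           ≤⟨ s≤s (unique-⊆⇒length≤ uxs xs⊆as++bs) ⟩
    suc (length (as ++ bs))   ≡⟨ cong suc (length-++ as) ⟩
    suc (length as + length bs)  ≡⟨ +-suc (length as) (length bs) ⟨
    length as + suc (length bs)  ≡⟨ length-++ as ⟨
    length (as ++ x ∷ bs)     ∎
    where
    open ≤-Reasoning
    xs⊆as++bs : ∀ {y} → y ∈ xs → y ∈ as ++ bs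
    xs⊆as++bs y∈xs with ∈-++⁻ as (xs⊆ys (there y∈xs))
    ... | inj₁ y∈as         = ∈-++⁺ˡ y∈as
    ... | inj₂ (here y≡x)   = contradiction (sym y≡x) (All.lookup x∉xs y∈xs)
    ... | inj₂ (there y∈bs) = ∈-++⁺ʳ as y∈bs

  -- A lower bound on a number of solutions that asks neither for finiteness nor for decidability of
  -- `P`, and is preserved by fibred products and injective images.
  AtLeast : ℕ → (A → Set) → Set
  AtLeast k P = ∃[ xs ] Unique xs × All P xs × k ≤ length xs

  atLeast-upTo : ∀ n → AtLeast n (_< n)
  atLeast-upTo n = upTo n , upTo⁺ n , All.tabulate ∈-upTo⁻ , ≤-reflexive (sym (length-upTo n))

  atLeast-map : (∀ {a} → P a → Q a) → AtLeast k P → AtLeast k Q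
  atLeast-map f (xs , uxs , pxs , k≤) = xs , uxs , All.map f pxs , k≤

  atLeast-Σ : {Q : A → B → Set} → AtLeast k P → (∀ {a} → P a → AtLeast l (Q a)) →
              AtLeast (k * l) (λ (a , b) → P a × Q a b)
  atLeast-Σ {A} {B} {k} {P} {l} {Q} (xs , uxs , pxs , k≤) f =
    let zs , uzs , qzs , l≤ = fibres uxs pxs in
    zs , uzs , All.map proj₂ qzs , ≤-trans (*-monoˡ-≤ l k≤) l≤
    where
    open ≤-Reasoning
    -- Recording `a ∈ xs` keeps the fibre over a new point disjoint from the fibres already listed.
    fibres : ∀ {xs} → Unique xs → All P xs →
             ∃[ zs ] Unique zs × All (λ (a , b) → a ∈ xs × P a × Q a b) zs × length xs * l ≤ length zs
    fibres [] [] = [] , [] , [] , z≤n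
    fibres {x ∷ xs} (x∉xs ∷ uxs) (px ∷ pxs) with f px | fibres uxs pxs
    ... | ys , uys , qys , l≤ys | zs , uzs , qzs , ≤zs =
      map (x ,_) ys ++ zs
      , ++⁺ (map⁺ ,-injectiveʳ uys) uzs disjoint
      , Allₚ.++⁺ (Allₚ.map⁺ (All.map (λ q → here refl , px , q) qys))
                 (All.map (λ (a∈xs , pq) → there a∈xs , pq) qzs)
      , (begin
          l + length xs * l                  ≤⟨ +-mono-≤ l≤ys ≤zs ⟩
          length ys + length zs              ≡⟨ cong (_+ length zs) (length-map (x ,_) ys) ⟨
          length (map (x ,_) ys) + length zs ≡⟨ length-++ (map (x ,_) ys) ⟨
          length (map (x ,_) ys ++ zs)       ∎)
      where
      disjoint : ∀ {v} → ¬ (v ∈ map (x ,_) ys × v ∈ zs)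
      disjoint (v∈₁ , v∈₂) with ∈-map⁻ (x ,_) v∈₁
      ... | _ , _ , refl = All.lookup x∉xs (proj₁ (All.lookup qzs v∈₂)) refl

  atLeast-× : AtLeast k P → AtLeast l Q → AtLeast (k * l) (λ (a , b) → P a × Q b)
  atLeast-× {l = l} {Q = Q} p q = atLeast-Σ {l = l} {Q = λ _ → Q} p (λ _ → q)

  -- A relation replaces a function because the image may depend on the proof of `P a`, for instance
  -- when an element of `Fin n` is built from a bound. Injectivity is asked of `R`, which does not
  -- see that proof.
  atLeast-image : (R : A → B → Set) → (∀ {a} → P a → ∃[ b ] R a b × Q b) →
                  (∀ {a a′ b} → P a → P a′ → R a b → R a′ b → a ≡ a′) →
                  AtLeast k P → AtLeast k Q
  atLeast-image {A} {B} {P} {Q} {k} R f inj (xs , uxs , pxs , k≤) =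
    let ys , uys , qys , ≡len = images uxs pxs in
    ys , uys , All.map proj₂ qys , subst (k ≤_) (sym ≡len) k≤
    where
    images : ∀ {xs} → Unique xs → All P xs →
             ∃[ ys ] Unique ys × All (λ b → (∃[ a ] a ∈ xs × P a × R a b) × Q b) ys × length ys ≡ length xs
    images [] [] = [] , [] , [] , refl
    images (x∉xs ∷ uxs) (px ∷ pxs) with f px | images uxs pxs
    ... | b , r , q | ys , uys , qys , ≡len =
      b ∷ ys
      , All.map (λ {((a , a∈ , pa , ra) , _) refl → All.lookup x∉xs a∈ (inj px pa r ra)}) qys ∷ uys
      , ((_ , here refl , px , r) , q) ∷ All.map (λ ((a , a∈ , s) , t) → (a , there a∈ , s) , t) qys
      , cong suc ≡len

  -- Coprime pairs

  length-filter+¬ : ∀ {P : A → Set} (P? : Decidable P) xs →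
                    length (filter P? xs) + length (filter (¬? ∘ P?) xs) ≡ length xs
  length-filter+¬ P? [] = refl
  length-filter+¬ P? (x ∷ xs) with P? x
  ... | yes _ = cong suc (length-filter+¬ P? xs)
  ... | no  _ = trans (+-suc _ _) (cong suc (length-filter+¬ P? xs))

  range : ℕ → List ℕ
  range n = map suc (upTo n)

  ∈-range⁺ : ∀ {m n} → 1 ≤ m → m ≤ n → m ∈ range n
  ∈-range⁺ {suc m} _ m≤n = ∈-map⁺ suc (∈-upTo⁺ m≤n)

  ∈-range⁻ : ∀ {m n} → m ∈ range n → 1 ≤ m × m ≤ n
  ∈-range⁻ m∈ with ∈-map⁻ suc m∈
  ... | _ , i∈ , refl = s≤s z≤n , ∈-upTo⁻ i∈

  length-range : ∀ n → length (range n) ≡ n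
  length-range n = trans (length-map suc (upTo n)) (length-upTo n)

  length-cartesianProduct : ∀ (xs : List A) (ys : List B) →
                            length (cartesianProduct xs ys) ≡ length xs * length ys
  length-cartesianProduct []       ys = refl
  length-cartesianProduct (x ∷ xs) ys = trans (length-++ (map (x ,_) ys))
    (cong₂ _+_ (length-map (x ,_) ys) (length-cartesianProduct xs ys))

  square : ℕ → List (ℕ × ℕ)
  square n = cartesianProduct (range n) (range n)

  length-square : ∀ n → length (square n) ≡ n * n
  length-square n = trans (length-cartesianProduct (range n) (range n))
    (cong₂ _*_ (length-range n) (length-range n))

  module _ (M : ℕ) where

    multiples : (d : ℕ) .{{_ : NonZero d}} → List (ℕ × ℕ)
    multiples d = map (λ (x , y) → x * d , y * d) (square (M / d))

    -- The pairs in [1, M]² with a common divisor in [2, k + 2].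
    common : ℕ → List (ℕ × ℕ)
    common zero    = multiples 2
    common (suc k) = multiples (3 + k) ++ common k

    length-multiples : ∀ d .{{_ : NonZero d}} → length (multiples d) ≡ M / d * (M / d)
    length-multiples d = trans (length-map _ (square (M / d))) (length-square (M / d))

    -- Σ_{2 ≤ d ≤ m} 1 / d² ≤ 3 / 4 - 1 / m, multiplied by 4 m M².
    length-common : ∀ k → 4 * (2 + k) * length (common k) + 4 * (M * M) ≤ 3 * (2 + k) * (M * M)
    length-common zero = begin
      8 * length (multiples 2) + 4 * (M * M)      ≡⟨ cong (λ z → 8 * z + 4 * (M * M)) (length-multiples 2) ⟩
      8 * (f * f) + 4 * (M * M)                   ≡⟨ eq₁ f (M * M) ⟩
      2 * (f * 2 * (f * 2)) + 4 * (M * M)         ≤⟨ +-monoˡ-≤ (4 * (M * M)) (*-monoʳ-≤ 2 (*-mono-≤ f≤ f≤)) ⟩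
      2 * (M * M) + 4 * (M * M)                   ≡⟨ *-distribʳ-+ (M * M) 2 4 ⟨
      6 * (M * M)                                 ∎
      where
      open ≤-Reasoning
      f = M / 2
      f≤ : f * 2 ≤ M
      f≤ = m/n*n≤m M 2
      eq₁ : ∀ f m → 8 * (f * f) + 4 * m ≡ 2 * (f * 2 * (f * 2)) + 4 * m
      eq₁ = solve-∀
    length-common (suc k) = *-cancelˡ-≤ m (+-cancelʳ-≤ (4 * (M * M)) _ _ (begin
      m * (4 * (1 + m) * length (common (suc k)) + 4 * (M * M)) + 4 * (M * M)
        ≡⟨ cong (λ z → m * (4 * (1 + m) * z + 4 * (M * M)) + 4 * (M * M)) len ⟩
      m * (4 * (1 + m) * (f * f + S) + 4 * (M * M)) + 4 * (M * M)
        ≡⟨ eq₁ m f S (M * M) ⟩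
      (1 + m) * (4 * m * S + 4 * (M * M)) + 4 * (m * f * (f * (1 + m)))
        ≤⟨ +-mono-≤ (*-monoʳ-≤ (1 + m) (length-common k)) (*-monoʳ-≤ 4 (*-mono-≤ mf≤ f≤)) ⟩
      (1 + m) * (3 * m * (M * M)) + 4 * (M * M)
        ≡⟨ eq₂ m (M * M) ⟩
      m * (3 * (1 + m) * (M * M)) + 4 * (M * M) ∎))
      where
      open ≤-Reasoning
      m = 2 + k
      f = M / (1 + m)
      S = length (common k)
      len : length (common (suc k)) ≡ f * f + S
      len = trans (length-++ (multiples (1 + m))) (cong (_+ S) (length-multiples (1 + m)))
      f≤ : f * (1 + m) ≤ M
      f≤ = m/n*n≤m M (1 + m)
      -- This relaxes (m + 1)² to m (m + 1), so that the sum telescopes.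
      mf≤ : m * f ≤ M
      mf≤ = ≤-trans (≤-trans (m≤n+m (m * f) f) (≤-reflexive (*-comm (1 + m) f))) f≤
      eq₁ : ∀ m f S q → m * (4 * (1 + m) * (f * f + S) + 4 * q) + 4 * q
                      ≡ (1 + m) * (4 * m * S + 4 * q) + 4 * (m * f * (f * (1 + m)))
      eq₁ = solve-∀
      eq₂ : ∀ m q → (1 + m) * (3 * m * q) + 4 * q ≡ m * (3 * (1 + m) * q) + 4 * q
      eq₂ = solve-∀

    ∈-multiples : ∀ {x y} d .{{_ : NonZero d}} → 1 ≤ x * d → x * d ≤ M → 1 ≤ y * d → y * d ≤ M →
                  (x * d , y * d) ∈ multiples d
    ∈-multiples {x} {y} d 1≤x x≤M 1≤y y≤M = ∈-map⁺ _
      (∈-cartesianProduct⁺ (∈-range⁺ (pos x 1≤x) (quot x x≤M))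
                           (∈-range⁺ (pos y 1≤y) (quot y y≤M)))
      where
      pos : ∀ z → 1 ≤ z * d → 1 ≤ z
      pos (suc z) _ = s≤s z≤n
      quot : ∀ z → z * d ≤ M → z ≤ M / d
      quot z zd≤M = subst (_≤ M / d) (m*n/n≡m z d) (/-monoˡ-≤ d zd≤M)

    multiples⊆common : ∀ {v} d k → d ≤ k → v ∈ multiples (2 + d) → v ∈ common k
    multiples⊆common zero zero _ v∈ = v∈
    multiples⊆common d (suc k) d≤ v∈ with m≤n⇒m<n∨m≡n d≤
    ... | inj₁ (s≤s d≤k) = ∈-++⁺ʳ (multiples (3 + k)) (multiples⊆common d k d≤k v∈)
    ... | inj₂ refl      = ∈-++⁺ˡ v∈

    -- The gcd itself serves as the common divisor: it is at most p ≤ 2 + k, hence among the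
    -- divisors that `common` collects.
    ¬coprime⇒∈common : ∀ {p q} → (p , q) ∈ square (2 + k) → 2 + k ≤ M →
                       ¬ Coprime p q → (p , q) ∈ common k
    ¬coprime⇒∈common {k} {p} {q} pq∈ ≤M ¬cop
      with gcd p q in eq | gcd[m,n]∣m p q | gcd[m,n]∣n p q | ∈-cartesianProduct⁻ (range (2 + k)) (range (2 + k)) pq∈
    ... | zero        | divides x p≡ | _            | p∈ , _ =
      contradiction (subst (1 ≤_) (trans p≡ (*-zeroʳ x)) (proj₁ (∈-range⁻ p∈))) λ ()
    ... | suc zero    | _            | _            | _ = ⊥-elim (¬cop (gcd≡1⇒coprime eq))
    ... | suc (suc d) | divides x refl | divides y refl | p∈ , q∈ =
      multiples⊆common d k (d≤k x (∈-range⁻ p∈))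
        (∈-multiples {x} {y} (2 + d) (proj₁ (∈-range⁻ p∈)) (≤-trans (proj₂ (∈-range⁻ p∈)) ≤M)
                             (proj₁ (∈-range⁻ q∈)) (≤-trans (proj₂ (∈-range⁻ q∈)) ≤M))
      where
      d≤k : ∀ x → 1 ≤ x * (2 + d) × x * (2 + d) ≤ 2 + k → d ≤ k
      d≤k (suc x) (_ , xd≤) = +-cancelˡ-≤ 2 d k (≤-trans (m≤m+n (2 + d) (x * (2 + d))) xd≤)

  CoprimePair : ℕ → ℕ × ℕ → Set
  CoprimePair M (p , q) = (1 ≤ p × p ≤ M) × (1 ≤ q × q ≤ M) × Coprime p q

  -- A union bound over all common divisors d ≥ 2 removes at most three quarters of the square. The
  -- side is even so that the remaining quarter is the integer h².
  atLeast-coprime : ∀ h → AtLeast (h * h) (CoprimePair (2 * h))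
  atLeast-coprime zero    = [] , [] , [] , z≤n
  atLeast-coprime (suc h) = good
    , filter⁺ cop? (cartesianProduct⁺ (urange M) (urange M))
    , All.tabulate (λ v∈ → let v∈sq , cop = ∈-filter⁻ cop? {xs = square M} v∈
                               p∈ , q∈ = ∈-cartesianProduct⁻ (range M) (range M) v∈sq
                           in ∈-range⁻ p∈ , ∈-range⁻ q∈ , cop)
    , *-cancelˡ-≤ 4 (+-cancelʳ-≤ (3 * (M * M)) _ _ (begin
        4 * (suc h * suc h) + 3 * (M * M)      ≡⟨ eq₁ (suc h) ⟩
        4 * (M * M)                            ≡⟨ cong (4 *_) (trans (length-filter+¬ cop? (square M)) (length-square M)) ⟨
        4 * (length good + length bad)         ≡⟨ *-distribˡ-+ 4 (length good) (length bad) ⟩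
        4 * length good + 4 * length bad       ≤⟨ +-monoʳ-≤ (4 * length good) (*-monoʳ-≤ 4 bad≤) ⟩
        4 * length good + 4 * length (common M j) ≤⟨ +-monoʳ-≤ (4 * length good) common≤ ⟩
        4 * length good + 3 * (M * M)          ∎))
    where
    open ≤-Reasoning
    M = 2 * suc h
    j = h + h
    M≡ : M ≡ 2 + j
    M≡ = eq h
      where
      eq : ∀ h → 2 * (1 + h) ≡ 2 + (h + h)
      eq = solve-∀
    cop? : Decidable (λ (v : ℕ × ℕ) → Coprime (proj₁ v) (proj₂ v))
    cop? (p , q) = coprime? p q
    good = filter cop? (square M)
    bad  = filter (¬? ∘ cop?) (square M)
    urange : ∀ n → Unique (range n)
    urange n = map⁺ suc-injective (upTo⁺ n)
    bad≤ : length bad ≤ length (common M j)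
    bad≤ = unique-⊆⇒length≤ (filter⁺ (¬? ∘ cop?) (cartesianProduct⁺ (urange M) (urange M)))
      λ {v} v∈ → let v∈sq , ¬cop = ∈-filter⁻ (¬? ∘ cop?) {xs = square M} v∈ in
             ¬coprime⇒∈common M (subst (λ z → v ∈ square z) M≡ v∈sq) (≤-reflexive (sym M≡)) ¬cop
    common≤ : 4 * length (common M j) ≤ 3 * (M * M)
    common≤ = *-cancelˡ-≤ (2 + j) (begin
      (2 + j) * (4 * length (common M j))               ≡⟨ eq (2 + j) (length (common M j)) ⟩
      4 * (2 + j) * length (common M j)                 ≤⟨ m≤m+n _ (4 * (M * M)) ⟩
      4 * (2 + j) * length (common M j) + 4 * (M * M)   ≤⟨ length-common M j ⟩
      3 * (2 + j) * (M * M)                             ≡⟨ eq′ (2 + j) (M * M) ⟩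
      (2 + j) * (3 * (M * M))                           ∎)
      where
      eq : ∀ m c → m * (4 * c) ≡ 4 * m * c
      eq = solve-∀
      eq′ : ∀ m c → 3 * m * c ≡ m * (3 * c)
      eq′ = solve-∀
    eq₁ : ∀ h → 4 * (h * h) + 3 * (2 * h * (2 * h)) ≡ 4 * (2 * h * (2 * h))
    eq₁ = solve-∀

  -- Vector pairs of given determinant

  -- A Bézout solution, scaled by E, is shifted along (p, q) until x < p; the equation then bounds
  -- y.
  coprime-solution : ∀ {p q} → Coprime p q → 1 ≤ p → ∀ E →
                     ∃[ x ] ∃[ y ] p * y ≡ q * x + E × x ≤ p × y ≤ q + E
  coprime-solution {suc p′} {q} cop _ E = x , y , p*y≡ , <⇒≤ x<p , *-cancelˡ-≤ p py≤
    where
    p = suc p′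
    solution : Bézout.Identity 1 p q → ∃[ x ] ∃[ y ] p * y ≡ q * x + E
    solution (Bézout.+- y x eq) = x * E , y * E ,
      trans (sym (*-assoc p y E)) (trans (cong (_* E) (trans (*-comm p y) (sym eq))) (eq₁ x q E))
      where
      eq₁ : ∀ x q e → (1 + x * q) * e ≡ q * (x * e) + e
      eq₁ = solve-∀
    -- Here q times the Bézout coefficient is 1 modulo p where -1 is needed; the factor `p′` = p - 1
    -- changes the sign without leaving ℕ.
    solution (Bézout.-+ y x eq) = x * E * p′ , E * (1 + y * p′) ,
      trans (eq₁ p′ y E) (trans (cong (λ z → z * (E * p′) + E) eq) (eq₂ x q E p′))
      where
      eq₁ : ∀ r y e → (1 + r) * (e * (1 + y * r)) ≡ (1 + y * (1 + r)) * (e * r) + e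
      eq₁ = solve-∀
      eq₂ : ∀ x q e r → x * q * (e * r) + e ≡ q * (x * e * r) + e
      eq₂ = solve-∀
    sol = solution (coprime-Bézout cop)
    x₀ = proj₁ sol
    y₀ = proj₁ (proj₂ sol)
    x = x₀ % p
    t = x₀ / p
    y = y₀ ∸ q * t
    x<p : x < p
    x<p = m%n<n x₀ p
    p*y≡ : p * y ≡ q * x + E
    p*y≡ = +-cancelʳ-≡ (p * (q * t)) _ _ (begin
      p * y + p * (q * t)        ≡⟨ *-distribˡ-+ p y (q * t) ⟨
      p * (y + q * t)            ≡⟨ cong (p *_) (m∸n+n≡m qt≤y₀) ⟩
      p * y₀                     ≡⟨ py₀≡ ⟩
      q * x + E + p * (q * t)    ∎)
      where
      open ≡-Reasoning
      eq₁ : ∀ q x t p e → q * (x + t * p) + e ≡ q * x + e + p * (q * t)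
      eq₁ = solve-∀
      py₀≡ : p * y₀ ≡ q * x + E + p * (q * t)
      py₀≡ = trans (proj₂ (proj₂ sol)) (trans (cong (λ z → q * z + E) (m≡m%n+[m/n]*n x₀ p)) (eq₁ q x t p E))
      qt≤y₀ : q * t ≤ y₀
      qt≤y₀ = *-cancelˡ-≤ p (≤-trans (m≤n+m (p * (q * t)) (q * x + E)) (≤-reflexive (sym py₀≡)))
    py≤ : p * y ≤ p * (q + E)
    py≤ = begin
      p * y          ≡⟨ p*y≡ ⟩
      q * x + E      ≤⟨ +-mono-≤ (*-monoʳ-≤ q (<⇒≤ x<p)) (m≤m+n E (p′ * E)) ⟩
      q * p + p * E  ≡⟨ cong (_+ p * E) (*-comm q p) ⟩
      p * q + p * E  ≡⟨ *-distribˡ-+ p q E ⟨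
      p * (q + E)    ∎
      where open ≤-Reasoning

  -- Adding k (p, q) to one small solution preserves the equation, and each step costs at most M in
  -- either coordinate.
  atLeast-solutions : ∀ {p q M} K E → Coprime p q → 1 ≤ p → p ≤ M → q ≤ M →
                      AtLeast K (λ (x , y) → p * y ≡ q * x + E × x ≤ M + K * M × y ≤ M + K * M + E)
  atLeast-solutions {p} {q} {M} K E cop 1≤p p≤M q≤M with coprime-solution cop 1≤p E
  ... | x , y , py≡ , x≤p , y≤ = atLeast-image (λ k v → v ≡ (x + k * p , y + k * q)) step
          (λ _ _ r r′ → inj (trans (sym r) r′)) (atLeast-upTo K)
    where
    instance _ = >-nonZero 1≤p
    inj : ∀ {k l} → (x + k * p , y + k * q) ≡ (x + l * p , y + l * q) → k ≡ l
    inj {k} {l} eq = *-cancelʳ-≡ k l p (+-cancelˡ-≡ x _ _ (cong proj₁ eq))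
    eq₁ : ∀ p q y k → p * (y + k * q) ≡ p * y + k * p * q
    eq₁ = solve-∀
    eq₂ : ∀ p q x k e → q * x + e + k * p * q ≡ q * (x + k * p) + e
    eq₂ = solve-∀
    eq₃ : ∀ m e k → m + e + k ≡ m + k + e
    eq₃ = solve-∀
    step : ∀ {k} → k < K → _
    step {k} k<K = _ , refl
      , trans (eq₁ p q y k) (trans (cong (_+ k * p * q) py≡) (eq₂ p q x k E))
      , +-mono-≤ (≤-trans x≤p p≤M) (*-mono-≤ (<⇒≤ k<K) p≤M)
      , ≤-trans (+-mono-≤ (≤-trans y≤ (+-monoˡ-≤ E q≤M)) (*-mono-≤ (<⇒≤ k<K) q≤M)) (≤-reflexive (eq₃ M E (K * M)))

  dyadic-unique : ∀ {g} i i′ → 2 ^ i ≤ g → g < 2 ^ suc i → 2 ^ i′ ≤ g → g < 2 ^ suc i′ → i ≡ i′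
  dyadic-unique i i′ a b c d with <-cmp i i′
  ... | tri≈ _ i≡i′ _ = i≡i′
  ... | tri< i<i′ _ _ = contradiction (≤-trans (^-monoʳ-≤ 2 i<i′) c) (<⇒≱ b)
  ... | tri> _ _ i′<i = contradiction (≤-trans (^-monoʳ-≤ 2 i′<i) a) (<⇒≱ d)

  -- Pairs of plane vectors (u, x), (v, y) spanning a parallelogram of area D.
  Pairing : ℕ → ℕ → ℕ → (ℕ × ℕ) × (ℕ × ℕ) → Set
  Pairing a b D ((u , v) , (x , y)) =
    ((1 ≤ u × u ≤ a) × (1 ≤ v × v ≤ a)) × (u * y ≡ v * x + D × x ≤ b × y ≤ b)

  ≤⇒∣! : ∀ {m n} → 1 ≤ m → m ≤ n → m ∣ n !
  ≤⇒∣! {suc m} _ m≤n = ∣-trans (m∣m*n (m !)) (m≤n⇒m!∣n! m≤n)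

  -- Write (u, v) = g (p, q) with p, q coprime and 2ⁱ ≤ g < 2ⁱ⁺¹; since g ∣ D = a!
  -- the equation becomes p y = q x + D / g. The scale i has 2ⁱ values of g, of the order of
  -- 4⁻ⁱ a² pairs (p, q) and 2ⁱ L solutions for each, so all s scales contribute equally.
  module _ (s L : ℕ) where
    private
      a = 2 ^ suc s

    atLeast-pairings : 4 * a ! ≤ L * a →
                       AtLeast (s * (2 ^ (s ∸ 1) * 2 ^ (s ∸ 1) * L)) (Pairing a (L * a) (a !))
    atLeast-pairings 4a!≤La = atLeast-image R value R-injective scales
      where
      Param : Set
      Param = ℕ × ((ℕ × (ℕ × ℕ)) × (ℕ × ℕ))
      -- Since g < 2ⁱ⁺¹ on scale i, the range p, q ≤ 2 h = a / 2ⁱ⁺¹ keeps g p and g q within a.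
      h : ℕ → ℕ
      h i = 2 ^ (s ∸ suc i)
      g : Param → ℕ
      g (i , (j , _) , _) = 2 ^ i + j
      Solution : ℕ → ℕ × ℕ → ℕ × ℕ → Set
      Solution G (p , q) (x , y) = G * (p * y) ≡ G * (q * x) + a ! × x ≤ L * a × y ≤ L * a
      OnScale : ℕ → (ℕ × (ℕ × ℕ)) × (ℕ × ℕ) → Set
      OnScale i ((j , pq) , xy) =
        (j < 2 ^ i × CoprimePair (2 * h i) pq) × Solution (2 ^ i + j) pq xy
      Valid : Param → Set
      Valid (i , w) = i < s × OnScale i w
      R : Param → (ℕ × ℕ) × (ℕ × ℕ) → Set
      R w@(_ , ((_ , (p , q)) , (x , y))) v = v ≡ ((g w * p , g w * q) , (x , y))

      module _ {i} (i<s : i < s) where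
        2^i*h : 2 ^ i * h i ≡ 2 ^ (s ∸ 1)
        2^i*h = trans (sym (^-distribˡ-+-* 2 i (s ∸ suc i))) (cong (2 ^_) (eq i<s))
          where
          eq : ∀ {i s} → i < s → i + (s ∸ suc i) ≡ s ∸ 1
          eq {i} {suc s} (s≤s i≤s) = m+[n∸m]≡n i≤s
        4*2^ : 2 ^ suc i * (2 * h i) ≡ a
        4*2^ = trans (eq₁ (2 ^ i) (h i)) (trans (cong (4 *_) 2^i*h) (eq₂ i<s))
          where
          eq₁ : ∀ x h → 2 * x * (2 * h) ≡ 4 * (x * h)
          eq₁ = solve-∀
          eq₂ : ∀ {i s} → i < s → 4 * 2 ^ (s ∸ 1) ≡ 2 ^ suc s
          eq₂ {i} {suc s} _ = *-assoc 2 2 (2 ^ s)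
        g< : ∀ {j} → j < 2 ^ i → 2 ^ i + j < 2 ^ suc i
        g< {j} j< = begin-strict
          2 ^ i + j       <⟨ +-monoʳ-< (2 ^ i) j< ⟩
          2 ^ i + 2 ^ i   ≡⟨ cong (2 ^ i +_) (+-identityʳ (2 ^ i)) ⟨
          2 ^ suc i       ∎
          where open ≤-Reasoning
        g≥1 : ∀ {j} → 1 ≤ 2 ^ i + j
        g≥1 {j} = ≤-trans (m^n>0 2 i) (m≤m+n (2 ^ i) j)
        gp≤a : ∀ {j p} → j < 2 ^ i → p ≤ 2 * h i → (2 ^ i + j) * p ≤ a
        gp≤a j< p≤ = ≤-trans (*-mono-≤ (<⇒≤ (g< j<)) p≤) (≤-reflexive 4*2^)
        g≤a : ∀ {j} → j < 2 ^ i → 2 ^ i + j ≤ a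
        g≤a {j} j< = ≤-trans (≤-reflexive (sym (*-identityʳ (2 ^ i + j))))
          (gp≤a j< (≤-trans (m^n>0 2 (s ∸ suc i)) (m≤m+n (h i) _)))

        solutions : ∀ {j p q} → j < 2 ^ i → CoprimePair (2 * h i) (p , q) →
          AtLeast (L * 2 ^ i) (Solution (2 ^ i + j) (p , q))
        solutions {j} {p} {q} j< ((1≤p , p≤) , (1≤q , q≤) , cop) with ≤⇒∣! g≥1 (g≤a j<)
        ... | divides E a!≡ = atLeast-map
                (λ { {x , y} (py≡ , x≤ , y≤) →
                     trans (cong (G *_) py≡) (trans (*-distribˡ-+ G (q * x) E)
                       (cong (G * (q * x) +_) (trans (*-comm G E) (sym a!≡))))
                     , ≤-trans x≤ (≤-trans (m≤m+n _ E) bound) , ≤-trans y≤ bound })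
                (atLeast-solutions (L * 2 ^ i) E cop 1≤p p≤ q≤)
          where
          G = 2 ^ i + j
          instance _ = >-nonZero (g≥1 {j})
          open ≤-Reasoning
          eq₁ : ∀ m l x e → 2 * (m + l * x * m + e) ≡ l * (2 * x * m) + 2 * (m + e)
          eq₁ = solve-∀
          eq₂ : ∀ x → 2 * (x + x) ≡ 4 * x
          eq₂ = solve-∀
          eq₃ : ∀ x → x + x ≡ 2 * x
          eq₃ = solve-∀
          m≤a! : 2 * h i ≤ a !
          m≤a! = begin
            2 * h i                ≤⟨ m≤n*m (2 * h i) (2 ^ suc i) {{>-nonZero (m^n>0 2 (suc i))}} ⟩
            2 ^ suc i * (2 * h i)  ≡⟨ 4*2^ ⟩
            a                      ≤⟨ n≤n! a ⟩
            a !                    ∎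
            where
            n≤n! : ∀ n → n ≤ n !
            n≤n! zero    = z≤n
            n≤n! (suc n) = m≤m*n (suc n) (n !) {{n !≢0}}
          E≤a! : E ≤ a !
          E≤a! = ≤-trans (m≤m*n E G) (≤-reflexive (sym a!≡))
          -- The progression takes exactly half of L a. The starting solution and E take at most a!
          -- each, and 4 a! ≤ L a pays for both out of the other half.
          bound : 2 * h i + L * 2 ^ i * (2 * h i) + E ≤ L * a
          bound = *-cancelˡ-≤ 2 (begin
            2 * (2 * h i + L * 2 ^ i * (2 * h i) + E)   ≡⟨ eq₁ (2 * h i) L (2 ^ i) E ⟩
            L * (2 ^ suc i * (2 * h i)) + 2 * (2 * h i + E)
              ≤⟨ +-mono-≤ (≤-reflexive (cong (L *_) 4*2^)) (*-monoʳ-≤ 2 (+-mono-≤ m≤a! E≤a!)) ⟩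
            L * a + 2 * (a ! + a !)                     ≡⟨ cong (L * a +_) (eq₂ (a !)) ⟩
            L * a + 4 * a !                             ≤⟨ +-monoʳ-≤ (L * a) 4a!≤La ⟩
            L * a + L * a                               ≡⟨ eq₃ (L * a) ⟩
            2 * (L * a)                                 ∎)

        scale : AtLeast (2 ^ (s ∸ 1) * 2 ^ (s ∸ 1) * L) (OnScale i)
        scale = subst (λ k → AtLeast k (OnScale i))
          (trans (eq (2 ^ i) (h i) L) (cong (λ z → z * z * L) 2^i*h))
          (atLeast-Σ (atLeast-× (atLeast-upTo (2 ^ i)) (atLeast-coprime (h i)))
                     (λ { {j , (p , q)} (j< , cop) → solutions {j} {p} {q} j< cop }))
          where
          eq : ∀ x h l → x * (h * h) * (l * x) ≡ x * h * (x * h) * l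
          eq = solve-∀

      scales : AtLeast (s * (2 ^ (s ∸ 1) * 2 ^ (s ∸ 1) * L)) Valid
      scales = atLeast-Σ (atLeast-upTo s) scale

      value : ∀ {w} → Valid w → ∃[ v ] R w v × Pairing a (L * a) (a !) v
      value {i , ((j , (p , q)) , (x , y))} (i<s , ((j< , ((1≤p , p≤) , (1≤q , q≤) , cop)) , (eq , x≤ , y≤))) =
        _ , refl
        , ((*-mono-≤ (g≥1 i<s) 1≤p , gp≤a i<s j< p≤) , (*-mono-≤ (g≥1 i<s) 1≤q , gp≤a i<s j< q≤))
        , trans (*-assoc G p y) (trans eq (cong (_+ a !) (sym (*-assoc G q x)))) , x≤ , y≤
        where G = 2 ^ i + j

      gcd-multiple : ∀ G {p q} → Coprime p q → gcd (G * p) (G * q) ≡ G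
      gcd-multiple G {p} {q} cop = trans (sym (c*gcd[m,n]≡gcd[cm,cn] G p q))
        (trans (cong (G *_) (coprime⇒gcd≡1 cop)) (*-identityʳ G))

      -- The factor g is recovered as gcd(u, v) because p and q are coprime. Cancelling it gives p
      -- and q, and its dyadic interval gives i and then j.
      R-injective : ∀ {w w′ v} → Valid w → Valid w′ → R w v → R w′ v → w ≡ w′
      R-injective {i , ((j , (p , q)) , (x , y))} {i′ , ((j′ , (p′ , q′)) , (x′ , y′))}
        (i<s , ((j< , (_ , _ , cop)) , _)) (i′<s , ((j′< , (_ , _ , cop′)) , _)) refl r = go i≡ j≡ p≡ q≡ x≡ y≡
        where
        go : i ≡ i′ → j ≡ j′ → p ≡ p′ → q ≡ q′ → x ≡ x′ → y ≡ y′ →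
             (i , ((j , (p , q)) , (x , y))) ≡ (i′ , ((j′ , (p′ , q′)) , (x′ , y′)))
        go refl refl refl refl refl refl = refl
        G = 2 ^ i + j
        G′ = 2 ^ i′ + j′
        instance _ = >-nonZero (g≥1 i<s {j})
        u≡ : G * p ≡ G′ * p′
        u≡ = cong (λ v → proj₁ (proj₁ v)) r
        v≡ : G * q ≡ G′ * q′
        v≡ = cong (λ v → proj₂ (proj₁ v)) r
        x≡ : x ≡ x′
        x≡ = cong (λ v → proj₁ (proj₂ v)) r
        y≡ : y ≡ y′
        y≡ = cong (λ v → proj₂ (proj₂ v)) r
        G≡ : G ≡ G′
        G≡ = trans (sym (gcd-multiple G cop)) (trans (cong₂ gcd u≡ v≡) (gcd-multiple G′ cop′))
        i≡ : i ≡ i′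
        i≡ = dyadic-unique i i′ (m≤m+n (2 ^ i) j) (g< i<s j<)
          (≤-trans (m≤m+n (2 ^ i′) j′) (≤-reflexive (sym G≡))) (≤-trans (≤-reflexive (cong suc G≡)) (g< i′<s j′<))
        j≡ : j ≡ j′
        j≡ = +-cancelˡ-≡ (2 ^ i) _ _ (trans G≡ (cong (λ z → 2 ^ z + j′) (sym i≡)))
        p≡ : p ≡ p′
        p≡ = *-cancelˡ-≡ p p′ G (trans u≡ (cong (_* p′) (sym G≡)))
        q≡ : q ≡ q′
        q≡ = *-cancelˡ-≡ q q′ G (trans v≡ (cong (_* q′) (sym G≡)))

  -- The size of the grid

  n<2^n : ∀ n → n < 2 ^ n
  n<2^n zero    = s≤s z≤n
  n<2^n (suc n) = begin-strict
    1 + n              <⟨ +-mono-≤-< (m^n>0 2 n) (n<2^n n) ⟩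
    2 ^ n + 2 ^ n      ≡⟨ cong (2 ^ n +_) (+-identityʳ (2 ^ n)) ⟨
    2 ^ suc n          ∎
    where open ≤-Reasoning

  -- Crude, but after two logarithms the loss is only a constant factor in s.
  n!≤2^n² : ∀ n → n ! ≤ 2 ^ (n * n)
  n!≤2^n² zero    = ≤-refl
  n!≤2^n² (suc n) = begin
    suc n * n !                  ≤⟨ *-mono-≤ (<⇒≤ (n<2^n (suc n))) (n!≤2^n² n) ⟩
    2 ^ suc n * 2 ^ (n * n)      ≡⟨ ^-distribˡ-+-* 2 (suc n) (n * n) ⟨
    2 ^ (suc n + n * n)          ≤⟨ ^-monoʳ-≤ 2 (+-monoʳ-≤ (suc n) (*-monoʳ-≤ n (n≤1+n n))) ⟩
    2 ^ (suc n * suc n)          ∎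
    where open ≤-Reasoning

  loglog : ℕ → ℕ
  loglog n = ⌊log₂ ⌊log₂ n ⌋ ⌋

  ≤loglog : ∀ k {n} → 2 ^ (2 ^ k) ≤ n → k ≤ loglog n
  ≤loglog k {n} h = subst (_≤ loglog n)
    (trans (cong ⌊log₂_⌋ (⌊log₂[2^n]⌋≡n (2 ^ k))) (⌊log₂[2^n]⌋≡n k)) (⌊log₂⌋-mono-≤ (⌊log₂⌋-mono-≤ h))

  2^2^loglog≤ : ∀ n → 2 ≤ n → 2 ^ (2 ^ loglog n) ≤ n
  2^2^loglog≤ n 2≤n = ≤-trans
    (^-monoʳ-≤ 2 (LogLemmas.2^⌊log₂⌋≤ ⌊log₂ n ⌋ (subst (_≤ ⌊log₂ n ⌋) (⌊log₂[2^n]⌋≡n 1) (⌊log₂⌋-mono-≤ 2≤n))))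
    (LogLemmas.2^⌊log₂⌋≤ n (≤-trans (s≤s z≤n) 2≤n))

  -- By a! ≤ 2^(a²) the exponent of the left side is at most 4 a² = 2^(2 s + 4). The hypothesis s ≥
  -- 1 makes a² large enough to absorb the summand 5.
  32a²a!≤ : ∀ s r → 2 * s + 4 ≤ r → 1 ≤ s → let a = 2 ^ suc s in 32 * (a * a) * a ! ≤ 2 ^ (2 ^ r)
  32a²a!≤ s r s≤r 1≤s = begin
    32 * (a * a) * a !                  ≡⟨ cong (λ z → 32 * z * a !) a²≡ ⟩
    2 ^ 5 * 2 ^ (2 * s + 2) * a !       ≡⟨ cong (_* a !) (^-distribˡ-+-* 2 5 (2 * s + 2)) ⟨
    2 ^ (5 + (2 * s + 2)) * a !         ≤⟨ *-monoʳ-≤ (2 ^ (5 + (2 * s + 2))) (n!≤2^n² a) ⟩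
    2 ^ (5 + (2 * s + 2)) * 2 ^ (a * a) ≡⟨ ^-distribˡ-+-* 2 (5 + (2 * s + 2)) (a * a) ⟨
    2 ^ (5 + (2 * s + 2) + a * a)       ≤⟨ ^-monoʳ-≤ 2 exponent ⟩
    2 ^ (2 ^ r)                         ∎
    where
    open ≤-Reasoning
    a = 2 ^ suc s
    c = 2 ^ (2 * s + 2)
    a²≡ : a * a ≡ c
    a²≡ = trans (sym (^-distribˡ-+-* 2 (suc s) (suc s))) (cong (2 ^_) (eq s))
      where
      eq : ∀ s → suc s + suc s ≡ 2 * s + 2
      eq = solve-∀
    eq₂ : ∀ c → c + c + c + c ≡ c * 4
    eq₂ = solve-∀
    5≤c : 5 ≤ c
    5≤c = ≤-trans (m≤m+n 5 11) (^-monoʳ-≤ 2 {4} {2 * s + 2} (+-monoˡ-≤ 2 (*-monoʳ-≤ 2 1≤s)))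
    exponent : 5 + (2 * s + 2) + a * a ≤ 2 ^ r
    exponent = begin
      5 + (2 * s + 2) + a * a   ≤⟨ +-mono-≤ (+-mono-≤ 5≤c (<⇒≤ (n<2^n (2 * s + 2)))) (≤-trans (≤-reflexive a²≡) (m≤m+n c c)) ⟩
      c + c + (c + c)           ≡⟨ +-assoc (c + c) c c ⟨
      c + c + c + c             ≡⟨ eq₂ c ⟩
      c * 2 ^ 2                 ≡⟨ ^-distribˡ-+-* 2 (2 * s + 2) 2 ⟨
      2 ^ (2 * s + 2 + 2)       ≡⟨ cong (2 ^_) (+-assoc (2 * s) 2 2) ⟩
      2 ^ (2 * s + 4)           ≤⟨ ^-monoʳ-≤ 2 s≤r ⟩
      2 ^ r                     ∎

  -- Abstract because a visible literal 16⁵ = 1048576 would be expanded in products.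
  abstract
    16⁵ : ℕ
    16⁵ = 16 ^ 5

    instance
      16⁵≢0 : NonZero 16⁵
      16⁵≢0 = _

    16⁵≡ : 16⁵ ≡ 16 * 16 * 16 * 16 * 16
    16⁵≡ = refl

  -- The constant k⁴ · 16 consists of k³ from the cube of n, k from r, and 16 from a² = 16 h². Both
  -- comparisons share one variable k, so that the ring identity contains no large numeral.
  cubic-bound : ∀ k {C n L a h s r} → C ≡ k * k * k * k * 16 → n ≤ k * (L * (a * a)) → r ≤ k * s → a ≡ 4 * h →
                n ^ 3 * r ≤ C * (s * (h * h * L) * (a * (L * a) * (a * (L * a))))
  cubic-bound k {C} {n} {L} {a} {h} {s} {r} refl n≤ r≤ refl = begin
    n ^ 3 * r                         ≤⟨ *-mono-≤ (^-monoˡ-≤ 3 n≤) r≤ ⟩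
    (k * (L * (a * a))) ^ 3 * (k * s) ≡⟨ eq k L h s ⟩
    k * k * k * k * 16 * (s * (h * h * L) * (a * (L * a) * (a * (L * a)))) ∎
    where
    open ≤-Reasoning
    eq : ∀ k l h s → let a = 4 * h in
         k * (l * (a * a)) * (k * (l * (a * a)) * (k * (l * (a * a)) * 1)) * (k * s)
         ≡ k * k * k * k * 16 * (s * (h * h * l) * (a * (l * a) * (a * (l * a))))
    eq = solve-∀

  grid-parameters : ∀ n → 2 ^ (2 ^ 6) ≤ n → ∃[ s ] ∃[ L ]
    let a = 2 ^ suc s ; b = L * a ; h = 2 ^ (s ∸ 1) in
    0 < b × 4 * a ! ≤ b × 4 * a * (2 * b) ≤ n ×
    n ^ 3 * suc (loglog n) ≤ 16⁵ * (s * (h * h * L) * (a * b * (a * b)))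
  grid-parameters n N≤n = s , L , 0<b , 4a!≤b , 8ab≤n , bound
    where
    open ≤-Reasoning
    r = loglog n
    -- For s ≥ 1 the required 2 s + 4 ≤ r follows from 6 s ≤ r. The threshold 2^(2^6) on n gives r ≥
    -- 6 and thereby s ≥ 1.
    s = r / 6
    a = 2 ^ suc s
    h = 2 ^ (s ∸ 1)
    6≤r : 6 ≤ r
    6≤r = ≤loglog 6 N≤n
    1≤s : 1 ≤ s
    1≤s = /-monoˡ-≤ 6 6≤r
    -- The 4 a columns of 2 b = 2 L a points use 8 a² L points, so L is the largest value that n
    -- allows.
    c = 8 * (a * a)
    instance
      c≢0 : NonZero c
      c≢0 = >-nonZero (*-mono-≤ {1} {8} {1} (s≤s z≤n) (*-mono-≤ (m^n>0 2 (suc s)) (m^n>0 2 (suc s))))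
    L = n / c
    b = L * a
    2s+4≤r : 2 * s + 4 ≤ r
    2s+4≤r = begin
      2 * s + 4        ≤⟨ +-monoʳ-≤ (2 * s) (*-monoʳ-≤ 4 1≤s) ⟩
      2 * s + 4 * s    ≡⟨ *-distribʳ-+ s 2 4 ⟨
      6 * s            ≡⟨ *-comm 6 s ⟩
      s * 6            ≤⟨ m/n*n≤m r 6 ⟩
      r                ∎
    2≤n : 2 ≤ n
    2≤n = ≤-trans (^-monoʳ-≤ 2 {1} {2 ^ 6} (s≤s z≤n)) N≤n
    4a!≤L : 4 * a ! ≤ L
    4a!≤L = subst (_≤ L) (m*n/n≡m (4 * a !) c) (/-monoˡ-≤ c (begin
      4 * a ! * (8 * (a * a))   ≡⟨ eq (a * a) (a !) ⟩
      32 * (a * a) * a !        ≤⟨ 32a²a!≤ s r 2s+4≤r 1≤s ⟩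
      2 ^ (2 ^ r)               ≤⟨ 2^2^loglog≤ n 2≤n ⟩
      n                         ∎))
      where
      eq : ∀ q f → 4 * f * (8 * q) ≡ 32 * q * f
      eq = solve-∀
    L≤b : L ≤ b
    L≤b = m≤m*n L a {{>-nonZero (m^n>0 2 (suc s))}}
    4a!≤b : 4 * a ! ≤ b
    4a!≤b = ≤-trans 4a!≤L L≤b
    1≤L : 1 ≤ L
    1≤L = ≤-trans (*-mono-≤ {1} {4} (s≤s z≤n) (1≤n! a)) 4a!≤L
    0<b : 0 < b
    0<b = ≤-trans 1≤L L≤b
    8ab≤n : 4 * a * (2 * b) ≤ n
    8ab≤n = ≤-trans (≤-reflexive (eq a L)) (m/n*n≤m n c)
      where
      eq : ∀ a l → 4 * a * (2 * (l * a)) ≡ l * (8 * (a * a))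
      eq = solve-∀
    n≤ : n ≤ 2 * L * c
    n≤ = begin
      n                ≡⟨ m≡m%n+[m/n]*n n c ⟩
      n % c + L * c    ≤⟨ +-monoˡ-≤ (L * c) (<⇒≤ (m%n<n n c)) ⟩
      c + L * c        ≤⟨ *-monoˡ-≤ c (+-monoˡ-≤ L 1≤L) ⟩
      (L + L) * c      ≡⟨ cong (λ z → (L + z) * c) (+-identityʳ L) ⟨
      2 * L * c        ∎
    -- A factor 12 would suffice; 16 agrees with n ≤ 16 L a², so one k serves both bounds.
    r< : suc r ≤ 16 * s
    r< = begin
      suc r            ≡⟨ cong suc (m≡m%n+[m/n]*n r 6) ⟩
      suc (r % 6) + s * 6   ≤⟨ +-mono-≤ (m%n<n r 6) (≤-reflexive (*-comm s 6)) ⟩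
      6 + 6 * s        ≤⟨ +-monoˡ-≤ (6 * s) (*-mono-≤ (m≤m+n 6 4) 1≤s) ⟩
      10 * s + 6 * s   ≡⟨ *-distribʳ-+ s 10 6 ⟨
      16 * s           ∎
    a≡4h : a ≡ 4 * h
    a≡4h = eq 1≤s
      where
      eq : ∀ {s} → 1 ≤ s → 2 ^ suc s ≡ 4 * 2 ^ (s ∸ 1)
      eq {suc s} _ = sym (*-assoc 2 2 (2 ^ s))
    bound : n ^ 3 * suc r ≤ 16⁵ * (s * (h * h * L) * (a * b * (a * b)))
    bound = cubic-bound 16 {16⁵} {n} {L} {a} {h} {s} {suc r} 16⁵≡ (≤-trans n≤ (≤-reflexive (eq L (a * a)))) r< a≡4h
      where
      eq : ∀ l q → 2 * l * (8 * q) ≡ 16 * (l * q)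
      eq = solve-∀

open Combinatorics

open import Defs
open import Data.Nat.Base using (suc; z≤n; s≤s; NonZero; _!; >-nonZero)
import Data.Nat.Properties as ℕₚ
import Data.Nat.DivMod as ℕd
open import Data.Nat.Divisibility using (n∣m*n)
import Data.Nat.Logarithm as Log
open import Data.Integer.Base using (+_)
open import Data.Rational.Base as ℚ using (ℚ; 0ℚ; 1ℚ; _/_)
import Data.Rational.Properties as ℚₚ
open import Data.Rational.Solver using (module +-*-Solver)
open import Algebra.Bundles using (CommutativeRing)
import Algebra.Properties.CommutativeSemiring.Exp as Exp
open import Data.Bool.Base using (if_then_else_)
open import Data.Fin.Base as Fin using (toℕ; fromℕ<)
import Data.Fin.Properties as Finₚ
open import Function.Bundles using (mk⇔)
open import Relation.Nullary.Decidable using (_×-dec_; dec-true; dec-false; map′)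
open LogLemmas
  using ( ι-cancel-≤; ι-mono-≤; ι-homo-*; ι-2^; /-homo-+; /-homo-*; /-mono-≤; 2ℚ; lower
        ; ^-mono-≤; 2^-cancel-≤; 0≤1; 1≤^; 1/suc>0; <2^1+⌊log₂⌋)

-- Logarithms and equality of reals on rational data

ι-injective : ∀ {m n} → ι m ≡ ι n → m ≡ n
ι-injective {m} {n} eq = ℕₚ.≤-antisym (ι-cancel-≤ {m} {n} (ℚₚ.≤-reflexive eq))
  (ι-cancel-≤ {n} {m} (ℚₚ.≤-reflexive (sym eq)))

ι-homo-+ : ∀ m n → ι (m ℕ.+ n) ≡ ι m ℚ.+ ι n
ι-homo-+ m n = trans (cong₂ (λ x y → ι (x ℕ.+ y)) (sym (ℕₚ.*-identityʳ m)) (sym (ℕₚ.*-identityʳ n))) (/-homo-+ m 0 n 0)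

/-*-cancel : ∀ m d .{{_ : NonZero d}} n → (+ m / d) ℚ.* ι (d ℕ.* n) ≡ ι (m ℕ.* n)
/-*-cancel m (suc d) n = trans (sym (/-homo-* m d (suc d ℕ.* n) 0)) (ℚₚ.≤-antisym
  (/-mono-≤ {m ℕ.* (suc d ℕ.* n)} {d ℕ.* 1} {m ℕ.* n} {0} (ℕₚ.≤-reflexive eq))
  (/-mono-≤ {m ℕ.* n} {0} {m ℕ.* (suc d ℕ.* n)} {d ℕ.* 1} (ℕₚ.≤-reflexive (sym eq))))
  where
  eq : m ℕ.* (suc d ℕ.* n) ℕ.* 1 ≡ m ℕ.* n ℕ.* (suc d ℕ.* 1)
  eq = trans (ℕₚ.*-identityʳ _) (trans (cong (m ℕ.*_) (ℕₚ.*-comm (suc d) n))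
    (trans (sym (ℕₚ.*-assoc m n (suc d))) (cong (m ℕ.* n ℕ.*_) (sym (ℕₚ.*-identityʳ (suc d))))))

-- The approximants round down, so the bound holds for every term without an error: 2^A ≤ max(q,
-- 1)^(k + 1) ≤ 2^(e (k + 1)).
log₂≈-upper : ∀ {q} e k → q ℚ.≤ ι (2 ^ e) → log₂≈ q k ℚ.≤ ι e
log₂≈-upper {q} e k q≤ = /-mono-≤ {A} {k} {e} {0}
  (subst (ℕ._≤ e ℕ.* suc k) (sym (ℕₚ.*-identityʳ A)) (2^-cancel-≤ A (e ℕ.* suc k) (begin
    2ℚ ^ℚ A                  ≤⟨ lower (q ℚ.⊔ 1ℚ) (suc k) 1≤ ⟩
    (q ℚ.⊔ 1ℚ) ^ℚ suc k      ≤⟨ ^-mono-≤ (suc k) (ℚₚ.≤-trans 0≤1 1≤) q⊔1≤ ⟩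
    (2ℚ ^ℚ e) ^ℚ suc k       ≡⟨ E.^-assocʳ 2ℚ e (suc k) ⟩
    2ℚ ^ℚ (e ℕ.* suc k)      ∎)))
  where
  open ℚₚ.≤-Reasoning
  module E = Exp (CommutativeRing.commutativeSemiring ℚₚ.+-*-commutativeRing)
  A = ⌊log₂ q ℚ.⊔ 1ℚ ^ suc k ⌋
  1≤ : 1ℚ ℚ.≤ q ℚ.⊔ 1ℚ
  1≤ = ℚₚ.p≤q⊔p q 1ℚ
  q⊔1≤ : q ℚ.⊔ 1ℚ ℚ.≤ 2ℚ ^ℚ e
  q⊔1≤ = ℚₚ.⊔-lub (subst (q ℚ.≤_) (ι-2^ e) q≤) (1≤^ e (ℚₚ.≤-trans (ℚₚ.p≤q⊔p 0ℚ 1ℚ) (ι-mono-≤ {1} {2} (s≤s z≤n))))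

≤-positive⇒≤0 : ∀ {q} → (∀ ε → 0ℚ ℚ.< ε → q ℚ.≤ ε) → q ℚ.≤ 0ℚ
≤-positive⇒≤0 {q} h = ℚₚ.≮⇒≥ λ 0<q →
  let m , 0<m , m<q = ℚₚ.<-dense 0<q in ℚₚ.<-irrefl refl (ℚₚ.<-≤-trans m<q (h m 0<m))

-- On such sequences `_≃_` reduces to equality in ℚ.
Constant : ℝ → ℚ → Set
Constant x q = ∀ n → seq x n ≡ q

≃⇒≡ : ∀ {x y p q} → Constant x p → Constant y q → x ≃ y → p ≡ q
≃⇒≡ {x} {y} {p} {q} x≡p y≡q x≃y = p-q≡0⇒p≡q (ℚₚ.∣p∣≡0⇒p≡0 (p ℚ.- q)
  (ℚₚ.≤-antisym (≤-positive⇒≤0 close′) (ℚₚ.0≤∣p∣ (p ℚ.- q))))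
  where
  open +-*-Solver
  close′ : ∀ ε → 0ℚ ℚ.< ε → ℚ.∣ p ℚ.- q ∣ ℚ.≤ ε
  close′ ε 0<ε = let N , h = x≃y ε 0<ε in
    subst₂ (λ r s → ℚ.∣ r ℚ.- s ∣ ℚ.≤ ε) (x≡p N) (y≡q N) (h N ℕₚ.≤-refl)
  p-q≡0⇒p≡q : p ℚ.- q ≡ 0ℚ → p ≡ q
  p-q≡0⇒p≡q eq = trans (sym (solve 2 (λ p q → (p :- q) :+ q := p) refl p q)) (trans (cong (ℚ._+ q) eq) (ℚₚ.+-identityˡ q))

≡⇒≃ : ∀ {x y q} → Constant x q → Constant y q → x ≃ y
≡⇒≃ {q = q} x≡q y≡q ε 0<ε = 0 , λ n _ → subst (ℚ._≤ ε)
  (sym (cong ℚ.∣_∣ (trans (cong₂ ℚ._-_ (x≡q n) (y≡q n)) (ℚₚ.+-inverseʳ q)))) (ℚₚ.<⇒≤ 0<ε)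

fromℕ-injective : ∀ {k l} → fromℕ k ≃ fromℕ l → k ≡ l
fromℕ-injective {k} {l} eq = ι-injective {k} {l} (≃⇒≡ {fromℕ k} {fromℕ l} (λ _ → refl) (λ _ → refl) eq)

-- Unit volume for rational points

fromℚ³ : ℚ → ℚ → ℚ → ℝ³
fromℚ³ x y z = ⟨ fromℚ x , fromℚ y , fromℚ z ⟩

module _ {n} (x y z : Fin n → ℚ) where

  unitTetrahedron? : Decidable (UnitTetrahedron (λ i → fromℚ³ (x i) (y i) (z i)))
  unitTetrahedron? (i , j , k , l) = i Finₚ.<? j ×-dec j Finₚ.<? k ×-dec k Finₚ.<? l ×-dec
    -- The volume of rational points is a constant sequence by computation, so its term at 0
    -- decides.
    map′ (λ eq → ≡⇒≃ {V} {1ℝ} (λ _ → eq) (λ _ → refl)) (≃⇒≡ {V} {1ℝ} (λ _ → refl) (λ _ → refl)) (seq V 0 ℚₚ.≟ 1ℚ)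
    where
    p : Fin n → ℝ³
    p i = fromℚ³ (x i) (y i) (z i)
    V = volume (p i) (p j) (p k) (p l)

-- Subtracting the second row from the third leaves two horizontal vectors (u, X, 0) and (v, Y, 0).
-- Of the remaining row only the height z then matters, and the positions drop out.
det-identity : ∀ x y u X r t v Y z →
  let a₁ = (x ℚ.+ u) ℚ.- x ; a₂ = (y ℚ.+ X) ℚ.- y ; a₃ = 0ℚ ℚ.- 0ℚ
      b₁ = r ℚ.- x       ; b₂ = t ℚ.- y       ; b₃ = z ℚ.- 0ℚ
      c₁ = (r ℚ.+ v) ℚ.- x ; c₂ = (t ℚ.+ Y) ℚ.- y ; c₃ = z ℚ.- 0ℚ
  in a₁ ℚ.* (b₂ ℚ.* c₃ ℚ.- b₃ ℚ.* c₂) ℚ.- a₂ ℚ.* (b₁ ℚ.* c₃ ℚ.- b₃ ℚ.* c₁) ℚ.+ a₃ ℚ.* (b₁ ℚ.* c₂ ℚ.- b₂ ℚ.* c₁)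
     ≡ z ℚ.* (v ℚ.* X) ℚ.- z ℚ.* (u ℚ.* Y)
det-identity = solve 9 (λ x y u X r t v Y z →
  let a₁ = (x :+ u) :- x ; a₂ = (y :+ X) :- y ; a₃ = con 0ℚ :- con 0ℚ
      b₁ = r :- x       ; b₂ = t :- y       ; b₃ = z :- con 0ℚ
      c₁ = (r :+ v) :- x ; c₂ = (t :+ Y) :- y ; c₃ = z :- con 0ℚ
  in a₁ :* (b₂ :* c₃ :- b₃ :* c₂) :- a₂ :* (b₁ :* c₃ :- b₃ :* c₁) :+ a₃ :* (b₁ :* c₂ :- b₂ :* c₁)
     := z :* (v :* X) :- z :* (u :* Y)) refl
  where open +-*-Solver

volume≃1 : ∀ {p q r s} x y u X r₁ r₂ v Y z → z ℚ.* (u ℚ.* Y) ≡ z ℚ.* (v ℚ.* X) ℚ.+ ι 6 →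
  p ≡ fromℚ³ x y 0ℚ → q ≡ fromℚ³ (x ℚ.+ u) (y ℚ.+ X) 0ℚ →
  r ≡ fromℚ³ r₁ r₂ z → s ≡ fromℚ³ (r₁ ℚ.+ v) (r₂ ℚ.+ Y) z → volume p q r s ≃ 1ℝ
volume≃1 {p} {q} {r} {s} x y u X r₁ r₂ v Y z zuY≡ refl refl refl refl =
  ≡⇒≃ {volume p q r s} {1ℝ} (λ _ → cong (λ δ → (+ 1 / 6) ℚ.* ℚ.∣ δ ∣)
    (trans (det-identity x y u X r₁ r₂ v Y z)
      (trans (cong (λ w → z ℚ.* (v ℚ.* X) ℚ.- w) zuY≡) (cancel (z ℚ.* (v ℚ.* X)) (ι 6)))))
    (λ _ → refl)
  where
  open +-*-Solver
  cancel : ∀ p d → p ℚ.- (p ℚ.+ d) ≡ ℚ.- d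
  cancel = solve 2 (λ p d → p :- (p :+ d) := :- d) refl

-- Filtering all quadruples of indices yields the exact count; the witnesses form a duplicate-free
-- sublist up to order.
hasCardinality : ∀ {n k} {P : Fin n × Fin n × Fin n × Fin n → Set} → Decidable P → AtLeast k P →
                 ∃[ t ] HasCardinality P t × k ℕ.≤ t
hasCardinality {n} {k} {P} P? (xs , uxs , pxs , k≤) =
  _ , (filter P? all , filter⁺ P? uall ,
      (λ a → mk⇔ (λ a∈ → proj₂ (∈-filter⁻ P? {xs = all} a∈)) (∈-filter⁺ P? (∈all a))) , refl)
  , ℕₚ.≤-trans k≤ (unique-⊆⇒length≤ uxs λ {a} a∈ → ∈-filter⁺ P? (∈all a) (All.lookup pxs a∈))
  where
  fs = allFin n
  all = cartesianProduct fs (cartesianProduct fs (cartesianProduct fs fs))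
  uall = cartesianProduct⁺ (allFin⁺ n) (cartesianProduct⁺ (allFin⁺ n) (cartesianProduct⁺ (allFin⁺ n) (allFin⁺ n)))
  ∈all : ∀ a → a ∈ all
  ∈all (i , j , k , l) = ∈-cartesianProduct⁺ (∈-allFin i) (∈-cartesianProduct⁺ (∈-allFin j)
    (∈-cartesianProduct⁺ (∈-allFin k) (∈-allFin l)))

-- The point set

-- Points beyond the 4 a columns needed just continue the grid in the upper plane.
module Configuration (a b H D : ℕ) .{{_ : NonZero H}} .{{_ : NonZero D}} (2b≤H : 2 ℕ.* b ℕ.≤ H) where

  ζ : ℚ
  ζ = + 6 / D

  height : ℕ → ℚ
  height x = if does (x ℕₚ.<? 2 ℕ.* a) then 0ℚ else ζ

  point : ℕ → ℕ → ℝ³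
  point x y = fromℚ³ (ι x) (ι y) (height x)

  points : ∀ {n} → Fin n → ℝ³
  points i = point (toℕ i ℕ./ H) (toℕ i ℕ.% H)

  -- Column by column, so a later column has a larger index whatever the rows. As u, v ≥ 1 and the
  -- upper columns follow the lower ones, the four vertices come out in increasing order.
  index : ℕ → ℕ → ℕ
  index x y = y ℕ.+ x ℕ.* H

  index-/ : ∀ {x y} → y ℕ.< H → index x y ℕ./ H ≡ x
  index-/ {x} {y} y<H = trans (ℕd.+-distrib-/-∣ʳ y (n∣m*n x)) (cong₂ ℕ._+_ (ℕd.m<n⇒m/n≡0 y<H) (ℕd.m*n/n≡m x H))

  index-% : ∀ {x y} → y ℕ.< H → index x y ℕ.% H ≡ y
  index-% {x} {y} y<H = trans (ℕd.[m+kn]%n≡m%n y x H) (ℕd.m<n⇒m%n≡m y<H)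

  index-< : ∀ {x y x′} y′ → y ℕ.< H → x ℕ.< x′ → index x y ℕ.< index x′ y′
  index-< {x} {y} {x′} y′ y<H x<x′ = begin-strict
    y ℕ.+ x ℕ.* H     <⟨ ℕₚ.+-monoˡ-< (x ℕ.* H) y<H ⟩
    suc x ℕ.* H       ≤⟨ ℕₚ.*-monoˡ-≤ H x<x′ ⟩
    x′ ℕ.* H          ≤⟨ ℕₚ.m≤n+m (x′ ℕ.* H) y′ ⟩
    y′ ℕ.+ x′ ℕ.* H   ∎
    where open ℕₚ.≤-Reasoning

  index-injective : ∀ {x y x′ y′} → y ℕ.< H → y′ ℕ.< H → index x y ≡ index x′ y′ → x ≡ x′ × y ≡ y′
  index-injective {x} {y} {x′} {y′} y<H y′<H eq =
    trans (sym (index-/ {x} y<H)) (trans (cong (ℕ._/ H) eq) (index-/ {x′} y′<H)) ,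
    trans (sym (index-% {x} y<H)) (trans (cong (ℕ._% H) eq) (index-% {x′} y′<H))

  points-index : ∀ {n} {i : Fin n} {x y} → y ℕ.< H → toℕ i ≡ index x y → points i ≡ point x y
  points-index {x = x} y<H eq = cong₂ point (trans (cong (ℕ._/ H) eq) (index-/ {x} y<H))
                                            (trans (cong (ℕ._% H) eq) (index-% {x} y<H))

  -- The two grids lie over different columns, so the first two coordinates already separate the
  -- points.
  points-injective : ∀ {n} → Injective {A = Fin n} _≡_ _≃³_ points
  points-injective {n} {i} {j} (x≃ , y≃ , _) = Finₚ.toℕ-injective (trans (ℕd.m≡m%n+[m/n]*n (toℕ i) H)
    (trans (cong₂ (λ x y → y ℕ.+ x ℕ.* H)
             (fromℕ-injective {toℕ i ℕ./ H} {toℕ j ℕ./ H} x≃) (fromℕ-injective {toℕ i ℕ.% H} {toℕ j ℕ.% H} y≃))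
           (sym (ℕd.m≡m%n+[m/n]*n (toℕ j) H))))

  unit? : ∀ {n} → Decidable (UnitTetrahedron (points {n}))
  unit? = unitTetrahedron? (λ i → ι (toℕ i ℕ./ H)) (λ i → ι (toℕ i ℕ.% H)) (λ i → height (toℕ i ℕ./ H))

  height-low : ∀ {x} → x ℕ.< 2 ℕ.* a → height x ≡ 0ℚ
  height-low {x} x< = cong (if_then 0ℚ else ζ) (dec-true (x ℕₚ.<? 2 ℕ.* a) x<)

  height-high : ∀ {x} → 2 ℕ.* a ℕ.≤ x → height x ≡ ζ
  height-high {x} ≤x = cong (if_then 0ℚ else ζ) (dec-false (x ℕₚ.<? 2 ℕ.* a) (ℕₚ.≤⇒≯ ≤x))

  -- Starting points fill only a × b of the at least 2 a × 2 b places of a grid, so that adding a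
  -- vector with coordinates at most a and b stays inside.
  Position : ℕ × ℕ → Set
  Position (x , y) = x ℕ.< a × y ℕ.< b

  Placed : ((ℕ × ℕ) × (ℕ × ℕ)) × ((ℕ × ℕ) × (ℕ × ℕ)) → Set
  Placed (w , (c , e)) = Pairing a b D w × (Position c × Position e)

  atLeast-unit : ∀ {n k} → 4 ℕ.* a ℕ.* H ℕ.≤ n → AtLeast k (Pairing a b D) →
                 AtLeast (k ℕ.* (a ℕ.* b ℕ.* (a ℕ.* b))) (UnitTetrahedron (points {n}))
  atLeast-unit {n} 4aH≤n pairings = atLeast-image R tetrahedron R-injective
    (atLeast-× pairings (atLeast-× positions positions))
    where
    positions : AtLeast (a ℕ.* b) Position
    positions = atLeast-× (atLeast-upTo a) (atLeast-upTo b)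

    R : ((ℕ × ℕ) × (ℕ × ℕ)) × ((ℕ × ℕ) × (ℕ × ℕ)) → Fin n × Fin n × Fin n × Fin n → Set
    R (((u , v) , (X , Y)) , ((x , y) , (r , t))) (i , j , k , l) =
      toℕ i ≡ index x y × toℕ j ≡ index (x ℕ.+ u) (y ℕ.+ X) ×
      toℕ k ≡ index (2 ℕ.* a ℕ.+ r) t × toℕ l ≡ index (2 ℕ.* a ℕ.+ r ℕ.+ v) (t ℕ.+ Y)

    b≤H : b ℕ.≤ H
    b≤H = ℕₚ.≤-trans (ℕₚ.m≤m+n b _) 2b≤H

    sum< : ∀ {c x u} → x ℕ.< c → u ℕ.≤ c → x ℕ.+ u ℕ.< 2 ℕ.* c
    sum< {c} {x} {u} x<c u≤c = subst (x ℕ.+ u ℕ.<_)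
      (cong (c ℕ.+_) (sym (ℕₚ.+-identityʳ c))) (ℕₚ.+-mono-<-≤ x<c u≤c)

    tetrahedron : ∀ {w} → Placed w → ∃[ q ] R w q × UnitTetrahedron points q
    tetrahedron {((u , v) , (X , Y)) , ((x , y) , (r , t))}
      ((((1≤u , u≤a) , (1≤v , v≤a)) , (uY≡ , X≤b , Y≤b)) , ((x<a , y<b) , (r<a , t<b))) =
      (i , j , k , l) , (i≡ , j≡ , k≡ , l≡) , (i<j , j<k , k<l , unit)
      where
      r′ = 2 ℕ.* a ℕ.+ r
      y<H = ℕₚ.<-≤-trans y<b b≤H
      t<H = ℕₚ.<-≤-trans t<b b≤H
      y+X<H : y ℕ.+ X ℕ.< H
      y+X<H = ℕₚ.<-≤-trans (sum< y<b X≤b) 2b≤H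
      t+Y<H : t ℕ.+ Y ℕ.< H
      t+Y<H = ℕₚ.<-≤-trans (sum< t<b Y≤b) 2b≤H
      x+u<2a : x ℕ.+ u ℕ.< 2 ℕ.* a
      x+u<2a = sum< x<a u≤a
      r′+v<4a : r′ ℕ.+ v ℕ.< 4 ℕ.* a
      r′+v<4a = subst₂ ℕ._<_ (sym (ℕₚ.+-assoc (2 ℕ.* a) r v)) (sym (ℕₚ.*-distribʳ-+ a 2 2))
        (ℕₚ.+-monoʳ-< (2 ℕ.* a) (sum< r<a v≤a))
      p<q : index x y ℕ.< index (x ℕ.+ u) (y ℕ.+ X)
      p<q = index-< (y ℕ.+ X) y<H (subst (ℕ._≤ x ℕ.+ u) (ℕₚ.+-comm x 1) (ℕₚ.+-monoʳ-≤ x 1≤u))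
      q<r : index (x ℕ.+ u) (y ℕ.+ X) ℕ.< index r′ t
      q<r = index-< t y+X<H (ℕₚ.<-≤-trans x+u<2a (ℕₚ.m≤m+n (2 ℕ.* a) r))
      r<s : index r′ t ℕ.< index (r′ ℕ.+ v) (t ℕ.+ Y)
      r<s = index-< (t ℕ.+ Y) t<H (subst (ℕ._≤ r′ ℕ.+ v) (ℕₚ.+-comm r′ 1) (ℕₚ.+-monoʳ-≤ r′ 1≤v))
      s<n : index (r′ ℕ.+ v) (t ℕ.+ Y) ℕ.< n
      s<n = ℕₚ.<-≤-trans (index-< 0 t+Y<H r′+v<4a) 4aH≤n
      r<n = ℕₚ.<-trans r<s s<n
      q<n = ℕₚ.<-trans q<r r<n
      p<n = ℕₚ.<-trans p<q q<n
      i = fromℕ< p<n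
      j = fromℕ< q<n
      k = fromℕ< r<n
      l = fromℕ< s<n
      i≡ = Finₚ.toℕ-fromℕ< p<n
      j≡ = Finₚ.toℕ-fromℕ< q<n
      k≡ = Finₚ.toℕ-fromℕ< r<n
      l≡ = Finₚ.toℕ-fromℕ< s<n
      i<j : i Fin.< j
      i<j = subst₂ ℕ._<_ (sym i≡) (sym j≡) p<q
      j<k : j Fin.< k
      j<k = subst₂ ℕ._<_ (sym j≡) (sym k≡) q<r
      k<l : k Fin.< l
      k<l = subst₂ ℕ._<_ (sym k≡) (sym l≡) r<s
      unit : volume (points i) (points j) (points k) (points l) ≃ 1ℝ
      unit = volume≃1 (ι x) (ι y) (ι u) (ι X) (ι r′) (ι t) (ι v) (ι Y) ζ area
        (at y<H i≡ (height-low (ℕₚ.≤-<-trans (ℕₚ.m≤m+n x u) x+u<2a)))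
        (trans (at y+X<H j≡ (height-low x+u<2a)) (cong₂ (λ p q → fromℚ³ p q 0ℚ) (ι-homo-+ x u) (ι-homo-+ y X)))
        (at t<H k≡ (height-high 2a≤r′))
        (trans (at t+Y<H l≡ (height-high (ℕₚ.≤-trans 2a≤r′ (ℕₚ.m≤m+n r′ v))))
               (cong₂ (λ p q → fromℚ³ p q ζ) (ι-homo-+ r′ v) (ι-homo-+ t Y)))
        where
        2a≤r′ : 2 ℕ.* a ℕ.≤ r′
        2a≤r′ = ℕₚ.m≤m+n (2 ℕ.* a) r
        at : ∀ {i : Fin n} {x y z} → y ℕ.< H → toℕ i ≡ index x y → height x ≡ z → points i ≡ fromℚ³ (ι x) (ι y) z
        at {i} {x} {y} y<H i≡ h≡ = trans (points-index {i = i} {x} {y} y<H i≡) (cong (fromℚ³ (ι x) (ι y)) h≡)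
        area : ζ ℚ.* (ι u ℚ.* ι Y) ≡ ζ ℚ.* (ι v ℚ.* ι X) ℚ.+ ι 6
        area = trans (cong (ζ ℚ.*_) (trans (sym (ι-homo-* u Y)) (trans (cong ι uY≡) (ι-homo-+ (v ℕ.* X) D))))
          (trans (ℚₚ.*-distribˡ-+ ζ (ι (v ℕ.* X)) (ι D))
            (cong₂ ℚ._+_ (cong (ζ ℚ.*_) (ι-homo-* v X))
              (trans (cong (λ k → ζ ℚ.* ι k) (sym (ℕₚ.*-identityʳ D))) (/-*-cancel 6 D 1))))

    R-injective : ∀ {w w′ q} → Placed w → Placed w′ → R w q → R w′ q → w ≡ w′
    R-injective {((u , v) , (X , Y)) , ((x , y) , (r , t))} {((u′ , v′) , (X′ , Y′)) , ((x′ , y′) , (r′ , t′))}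
      ((_ , (_ , X≤b , Y≤b)) , ((x<a , y<b) , (r<a , t<b)))
      ((_ , (_ , X′≤b , Y′≤b)) , ((x′<a , y′<b) , (r′<a , t′<b)))
      (i≡ , j≡ , k≡ , l≡) (i≡′ , j≡′ , k≡′ , l≡′)
      with index-injective {x} {y} {x′} {y′} (ℕₚ.<-≤-trans y<b b≤H) (ℕₚ.<-≤-trans y′<b b≤H) (trans (sym i≡) i≡′)
         | index-injective {2 ℕ.* a ℕ.+ r} {t} {2 ℕ.* a ℕ.+ r′} {t′}
             (ℕₚ.<-≤-trans t<b b≤H) (ℕₚ.<-≤-trans t′<b b≤H) (trans (sym k≡) k≡′)
         | index-injective {x ℕ.+ u} {y ℕ.+ X} {x′ ℕ.+ u′} {y′ ℕ.+ X′}
             (ℕₚ.<-≤-trans (sum< y<b X≤b) 2b≤H) (ℕₚ.<-≤-trans (sum< y′<b X′≤b) 2b≤H) (trans (sym j≡) j≡′)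
         | index-injective {2 ℕ.* a ℕ.+ r ℕ.+ v} {t ℕ.+ Y} {2 ℕ.* a ℕ.+ r′ ℕ.+ v′} {t′ ℕ.+ Y′}
             (ℕₚ.<-≤-trans (sum< t<b Y≤b) 2b≤H) (ℕₚ.<-≤-trans (sum< t′<b Y′≤b) 2b≤H) (trans (sym l≡) l≡′)
    ... | refl , refl | 2a+r≡ , refl | x+u≡ , y+X≡ | r+v≡ , t+Y≡
      with ℕₚ.+-cancelˡ-≡ (2 ℕ.* a) _ _ 2a+r≡
    ... | refl
      with ℕₚ.+-cancelˡ-≡ x _ _ x+u≡ | ℕₚ.+-cancelˡ-≡ y _ _ y+X≡
         | ℕₚ.+-cancelˡ-≡ (2 ℕ.* a ℕ.+ r) _ _ r+v≡ | ℕₚ.+-cancelˡ-≡ t _ _ t+Y≡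
    ... | refl | refl | refl | refl = refl

  abstract
    many-unit-tetrahedra : ∀ {n k} → 4 ℕ.* a ℕ.* H ℕ.≤ n → AtLeast k (Pairing a b D) →
      ∃[ p ] Injective {A = Fin n} _≡_ _≃³_ p × (∃[ t ] HasCardinality (UnitTetrahedron p) t ×
      k ℕ.* (a ℕ.* b ℕ.* (a ℕ.* b)) ℕ.≤ t)
    many-unit-tetrahedra {n} 4aH≤n pairings =
      points , points-injective , hasCardinality (unit? {n}) (atLeast-unit {n} 4aH≤n pairings)

-- From the integer count to the real inequality

log₂-upper : ∀ x e → (∀ k → seq x k ℚ.≤ ι (2 ^ e)) → ∀ k → seq (log₂ x) k ℚ.≤ ι e
log₂-upper x e x≤ k = log₂≈-upper {seq x k} e k (x≤ k)

-- Rounding up twice costs a single `suc`: the strict bound m < 2^(⌊log₂ m⌋ + 1) also covers m + 1,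
-- which is the inner logarithm rounded up.
log₂log₂≤ : ∀ n k → seq (log₂ (log₂ (fromℕ n))) k ℚ.≤ ι (suc (loglog n))
log₂log₂≤ n = log₂-upper (log₂ (fromℕ n)) (suc (loglog n)) λ k → ℚₚ.≤-trans
  (log₂-upper (fromℕ n) (suc Log.⌊log₂ n ⌋)
    (λ _ → ι-mono-≤ {n} {2 ^ suc Log.⌊log₂ n ⌋} (ℕₚ.<⇒≤ (<2^1+⌊log₂⌋ n))) k)
  (ι-mono-≤ {suc Log.⌊log₂ n ⌋} {2 ^ suc (loglog n)} (<2^1+⌊log₂⌋ Log.⌊log₂ n ⌋))

1/>0 : ∀ d .{{_ : NonZero d}} → 0ℚ ℚ.< + 1 / d
1/>0 (suc d) = 1/suc>0 d

scaled-≤ : ∀ c m (x : ℝ) {r t} → 0ℚ ℚ.≤ c → 0ℚ ℚ.≤ m → (∀ k → seq x k ℚ.≤ r) →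
           c ℚ.* (m ℚ.* r) ℚ.≤ t → fromℚ c * (fromℚ m * x) ≤ fromℚ t
scaled-≤ c m x {r} {t} 0≤c 0≤m x≤r cmr≤t ε 0<ε = 0 , λ k _ → (begin
  c ℚ.* (m ℚ.* seq x k)  ≤⟨ ℚₚ.*-monoˡ-≤-nonNeg c {{ℚ.nonNegative 0≤c}} (ℚₚ.*-monoˡ-≤-nonNeg m {{ℚ.nonNegative 0≤m}} (x≤r k)) ⟩
  c ℚ.* (m ℚ.* r)        ≤⟨ cmr≤t ⟩
  t                      ≡⟨ ℚₚ.+-identityʳ t ⟨
  t ℚ.+ 0ℚ               ≤⟨ ℚₚ.+-monoʳ-≤ t (ℚₚ.<⇒≤ 0<ε) ⟩
  t ℚ.+ ε                ∎)
  where open ℚₚ.≤-Reasoning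

1/d*[m*r]≤t : ∀ d .{{_ : NonZero d}} m r t → m ℕ.* r ℕ.≤ d ℕ.* t → (+ 1 / d) ℚ.* (ι m ℚ.* ι r) ℚ.≤ ι t
1/d*[m*r]≤t d m r t h = begin
  (+ 1 / d) ℚ.* (ι m ℚ.* ι r)  ≡⟨ cong ((+ 1 / d) ℚ.*_) (ι-homo-* m r) ⟨
  (+ 1 / d) ℚ.* ι (m ℕ.* r)    ≤⟨ ℚₚ.*-monoˡ-≤-nonNeg (+ 1 / d) {{ℚ.nonNegative (ℚₚ.<⇒≤ (1/>0 d))}} (ι-mono-≤ h) ⟩
  (+ 1 / d) ℚ.* ι (d ℕ.* t)    ≡⟨ /-*-cancel 1 d t ⟩
  ι (1 ℕ.* t)                  ≡⟨ cong ι (ℕₚ.*-identityˡ t) ⟩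
  ι t                          ∎
  where open ℚₚ.≤-Reasoning

mainTheorem4 : ∃[ c ] 0ℝ < c × (∃[ N ] ∀ n → N ℕ.≤ n →
    ∃[ p ] Injective {A = Fin n} _≡_ _≃³_ p × (∃[ t ] HasCardinality (UnitTetrahedron p) t ×
    c * (fromℕ (n ^ 3) * log₂ (log₂ (fromℕ n))) ≤ fromℕ t))
mainTheorem4 = fromℚ c , (c , 1/>0 16⁵ , 0 , λ _ _ → ℚₚ.≤-reflexive (ℚₚ.+-identityˡ c))
  , 2 ^ (2 ^ 6) , λ n N≤n →
    let s , L , 0<b , 4a!≤b , size , bound = grid-parameters n N≤n
        a = 2 ^ suc s
        b = L ℕ.* a
        p , p-injective , t , card , ≤t = Configuration.many-unit-tetrahedra a b (2 ℕ.* b) (a !)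
          {{>-nonZero (ℕₚ.≤-trans 0<b (ℕₚ.m≤m+n b _))}} {{a ℕₚ.!≢0}} ℕₚ.≤-refl size (atLeast-pairings s L 4a!≤b)
    in p , p-injective , t , card ,
       scaled-≤ c (ι (n ^ 3)) (log₂ (log₂ (fromℕ n))) (ℚₚ.<⇒≤ (1/>0 16⁵)) (ι-mono-≤ {0} {n ^ 3} ℕ.z≤n)
         (log₂log₂≤ n) (1/d*[m*r]≤t 16⁵ (n ^ 3) (suc (loglog n)) t (ℕₚ.≤-trans bound (ℕₚ.*-monoʳ-≤ 16⁵ ≤t)))
  where
  c : ℚ
  c = + 1 / 16⁵
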